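{- Let $q$ be a prime power, $\xi$ a primitive element of $\mathbb{F}_q$, $\ell$ a positive divisor of $q-1$, $r$ a positive integer, and $a_0,\ldots,a_{\ell-1}\in\mathbb{F}_q^*$ all lying in the same cyclotomic coset $C_j$ of index $\ell$. Suppose $f(x)\in\mathbb{F}_q[x]$ is a permutation polynomial of $\mathbb{F}_q$ with $f(0)=0$ and $f(x)=a_ix^r$ for all $x\in C_i$, $i=0,\ldots,\ell-1$. Then $$Crk(f)\ge q-\max\big\{3q^{1/2},\ \mathcal{L}(f),\ \mathcal{I}(f)\big\}.$$
   Context: Cyclotomic cosets of index $\ell$: $C_0=\{\xi^{k\ell}: k=0,\ldots,(q-1)/\ell-1\}$ (the subgroup of nonzero $\ell$-th powers) and $C_i=\xi^iC_0$ for $i=0,\ldots,\ell-1$. Let $x^{q-2}$ denote the map sending $0\mapsto0$ and $x\mapsto x^{ -1}$ for $x\ne0$. The Carlitz rank $Crk(f)$ of a permutation polynomial $f$ of $\mathbb{F}_q$ is the smallest integer $n\ge0$ such that $f$ coincides on $\mathbb{F}_q$ with $P_n(x)=(\ldots((c_0x+c_1)^{q-2}+c_2)^{q-2}\ldots+c_n)^{q-2}+c_{n+1}$ for some $c_i\in\mathbb{F}_q$ with $c_i\neq0$ for $i=0,2,\ldots,n$. Linearity: $\mathcal{L}(f)=\max_{a\in\mathbb{F}_q^*}|\{c\in\mathbb{F}_q: f(c)=ac\}|$. Invertibility: $\mathcal{I}(f)=\max_{c\in\mathbb{F}_q^*}|\{x\in\mathbb{F}_q^*: f(x)=c/x\}|$.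 -}

module Defs where

open import Level using (0ℓ)
open import Data.Nat as ℕ using (ℕ; zero; suc; _≤_; _<_; _∸_)
open import Data.Nat.Primality using (Prime)
open import Data.Nat.DivMod using (_/_)
open import Data.Nat.Divisibility using (_∣_)
open import Data.Fin using (Fin)
open import Data.List using (List; map; filter; length; foldr)
open import Data.List.Base using (allFin)
open import Data.Product using (Σ; ∃; ∃-syntax; _×_; _,_)
open import Relation.Nullary using (¬_; Dec; yes; no)
open import Relation.Nullary using (¬?)
open import Relation.Binary.PropositionalEquality using (_≡_)
open import Function.Bundles using (_↔_; Inverse)
open import Function.Definitions using (Injective)
open import Algebra.Structures using (IsCommutativeRing)

-- A finite field with q elements, with propositional equality.
-- The inverse is total, with the convention 0 ⁻¹ = 0; this is exactly
-- the map x ↦ x^(q-2) of the paper.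

record FiniteField : Set₁ where
  infixl 6 _+_
  infixl 7 _*_
  field
    q        : ℕ
    Carrier  : Set
    _+_ _*_  : Carrier → Carrier → Carrier
    -_       : Carrier → Carrier
    0# 1#    : Carrier
    isCommutativeRing : IsCommutativeRing _≡_ _+_ _*_ -_ 0# 1#
    _⁻¹      : Carrier → Carrier
    0≢1      : ¬ (0# ≡ 1#)
    ⁻¹-inverse : ∀ x → ¬ (x ≡ 0#) → x * (x ⁻¹) ≡ 1#
    0⁻¹≡0    : 0# ⁻¹ ≡ 0#
    enumeration : Fin q ↔ Carrier
    _≟_      : (x y : Carrier) → Dec (x ≡ y)

  _^_ : Carrier → ℕ → Carrier
  x ^ zero  = 1#
  x ^ suc n = x * (x ^ n)

  elements : List Carrier
  elements = map (Inverse.to enumeration) (allFin q)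

  nonzeroElements : List Carrier
  nonzeroElements = filter (λ x → ¬? (x ≟ 0#)) elements

  -- the map x ↦ x^(q-2)  (0 ↦ 0, x ↦ x⁻¹ otherwise)
  inv : Carrier → Carrier
  inv x = x ⁻¹

module _ (F : FiniteField) where
  open FiniteField F

  IsPrimePower : ℕ → Set
  IsPrimePower n = ∃[ p ] ∃[ k ] (Prime p × 1 ≤ k × n ≡ p ℕ.^ k)

  IsPrimitive : Carrier → Set
  IsPrimitive ξ = ¬ (ξ ≡ 0#) × (∀ k → 1 ≤ k → k < q ∸ 1 → ¬ (ξ ^ k ≡ 1#))

  InCoset : (ξ : Carrier) (ℓ : ℕ) .{{_ : ℕ.NonZero ℓ}} → ℕ → Carrier → Set
  InCoset ξ ℓ i x = ∃[ k ] (k < (q ∸ 1) / ℓ × x ≡ ξ ^ (i ℕ.+ k ℕ.* ℓ))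

  -- f is a permutation of F_q (F_q is finite, so injective ⇔ bijective)
  IsPermutation : (Carrier → Carrier) → Set
  IsPermutation f = Injective _≡_ _≡_ f

  maxList : List ℕ → ℕ
  maxList = foldr ℕ._⊔_ 0

  linCount : (Carrier → Carrier) → Carrier → ℕ
  linCount f a = length (filter (λ c → f c ≟ (a * c)) elements)

  linearity : (Carrier → Carrier) → ℕ
  linearity f = maxList (map (linCount f) nonzeroElements)

  invCount : (Carrier → Carrier) → Carrier → ℕ
  invCount f c = length (filter (λ x → f x ≟ (c * (x ⁻¹))) nonzeroElements)

  invertibility : (Carrier → Carrier) → ℕ
  invertibility f = maxList (map (invCount f) nonzeroElements)

  -- P_n(x) = (…((c_0 x + c_1)^(q-2) + c_2)^(q-2) … + c_n)^(q-2) + c_(n+1),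
  -- given the constants c : Fin (n+2) → F_q as c 0, …, c (n+1).
  -- Inner part Q_m(x) = (…((c_0 x + c_1)^(q-2) + c_2)^(q-2) … )^(q-2) + c_(m+1)
  -- (m applications of the inversion).
  carlitzInner : (m : ℕ) → (ℕ → Carrier) → Carrier → Carrier
  carlitzInner zero    c x = c 0 * x + c 1
  carlitzInner (suc m) c x = inv (carlitzInner m c x) + c (suc (suc m))

  -- f is represented by a P_n with constants c_0, …, c_(n+1) (entries of c
  -- beyond index n+1 are irrelevant), with c_0, c_2, …, c_n all nonzero.
  CarlitzRep : (Carrier → Carrier) → ℕ → (ℕ → Carrier) → Set
  CarlitzRep f n c =
    ¬ (c 0 ≡ 0#) ×
    (∀ i → 2 ≤ i → i ≤ n → ¬ (c i ≡ 0#)) ×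
    (∀ x → f x ≡ carlitzInner n c x)

{-# OPTIONS --safe #-}
module Submission where

-- A Carlitz representation of length n makes f agree with a Moebius map R = (α x + β) / (γ x + δ)
-- off at most n points. If R is neither b x nor b / x, let K be the number of x ≠ 0 with f x = R x,
-- and put q - 1 = Q = ℓ m. Two estimates together force (K + 1)² ≤ 9 q.
--   * f (u x) = u ^ r f x for u in C₀, so for u ≠ v in C₀ the equations f (u x) = R (u x) and
--     f (v x) = R (v x) leave a nonzero quadratic for x; with the Cauchy-Schwarz inequality
--     over the cosets this gives m K² ≤ Q (K + 2 (m - 1)), which settles small ℓ.
--   * f x = R x implies (α x + β) ^ m = κ x ^ (r m) (γ x + δ) ^ m, as all a i lie in the same coset.
--     Stepanov's method, with an auxiliary polynomial of degree < 2 Q that has a zero of order M at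
--     each such x, gives K M < 2 Q whenever M (m + M - 1) < Q, which settles large ℓ.

open import Defs
open import Level using (0ℓ)
open import Algebra.Bundles using (CommutativeRing)
open import Data.Nat as ℕ using (ℕ; zero; suc; z≤n; s≤s)
import Data.Nat.Properties as ℕₚ
import Data.Nat.DivMod as DivMod
open import Data.Nat.Divisibility using (_∣_)
open import Data.Nat.GeneralisedArithmetic using (fold)
open import Data.Nat.ListAction using () renaming (sum to sum-ℕ)
import Data.Nat.Solver as NatSolver
open import Data.Fin as Fin using (Fin; toℕ)
import Data.Fin.Properties as Finₚ
open import Data.List using (List; []; _∷_; _++_; length; map; lookup; applyUpTo; upTo; filter)
import Data.List.Properties as Listₚ
open import Data.List.Membership.Propositional using (_∈_)
import Data.List.Membership.Propositional.Properties as ∈ₚ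
open import Data.List.Relation.Unary.Any using (index; here; there)
open import Data.List.Relation.Unary.Any.Properties using (lookup-index)
open import Data.List.Relation.Unary.All as All using (All; []; _∷_)
import Data.List.Relation.Unary.All.Properties as Allₚ
open import Data.List.Relation.Unary.AllPairs as AllPairs using (AllPairs; []; _∷_)
import Data.List.Relation.Unary.AllPairs.Properties as AllPairsₚ
open import Data.List.Relation.Unary.Unique.Propositional using (Unique)
open import Data.Product using (∃-syntax; _×_; _,_; proj₁; proj₂)
open import Data.Sum using (_⊎_; inj₁; inj₂)
open import Function using (_∘_)
open import Function.Bundles using (Inverse)
open import Relation.Nullary using (¬_; Dec; yes; no; contradiction; ¬?)
open import Relation.Nullary.Decidable using (_→-dec_; _×-dec_; from-yes)
open import Relation.Unary using (Pred; Decidable)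
open import Relation.Binary.Definitions using (tri<; tri≈; tri>)
open import Relation.Binary.PropositionalEquality

-- The two estimates are chained rather than chosen by a case split on `ℓ`. If `K²` is about `9 Q`,
-- the pair count gives `m K ≤ 9 Q / 7`. Stepanov's method is contradicted once `M`, about
-- `2 Q / K`, satisfies `(M + 1) (m + M) < Q`. Times `K²`, the left side is about
-- `2 Q (2 Q + m K) ≤ (46/7) Q²`, against `Q K²`, about `9 Q²`; the gap between 46/7 and 9 pays for
-- the lower-order terms, up to a finite check for small `K`. The obstacle in Stepanov's method is
-- the cost of a high-order zero: the products `z ^ e X(z) ^ u Y(z) ^ w` have degree near `2 Q`. Two
-- devices reduce order `k` to `m + 2 k` linear conditions: on the curve the product has the value
-- `κ ^ b s ^ i` with `i < m`, and the substitution `t = s X(s) Y(s) τ` clears all denominators from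
-- its expansion at `s`. Taylor coefficients replace derivatives, so the characteristic does not
-- matter. The products are independent because their lowest terms `z ^ e` differ; this needs
-- nonzero constant terms in `X` and `Y`, which is where `b x` and `b / x` drop out.

module FieldProperties (F : FiniteField) where

  open FiniteField F

  -- Field arithmetic and powers.

  commutativeRing : CommutativeRing 0ℓ 0ℓ
  commutativeRing = record { isCommutativeRing = isCommutativeRing }

  open CommutativeRing commutativeRing public
    using ( +-congˡ; +-congʳ; *-congˡ; *-congʳ; +-assoc; +-comm; +-identityˡ; +-identityʳ; -‿inverseˡ; -‿inverseʳ
          ; *-assoc; *-comm; *-identityˡ; *-identityʳ; zeroˡ; zeroʳ
          ; distribˡ; distribʳ; semiring; ring; commutativeSemiring )
  open import Algebra.Properties.Ring ring public
    using (-‿distribˡ-*)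
  open import Algebra.Properties.Group (CommutativeRing.+-group commutativeRing) public
    using () renaming (x∙y⁻¹≈ε⇒x≈y to x-y≡0⇒x≡y; ∙-cancelˡ to +-cancelˡ; inverseʳ-unique to +-inverseʳ-unique)
  open import Algebra.Properties.Semiring.Sum semiring public
    using (sum; sum-cong-≗; ∑-distrib-+; ∑-comm; *-distribˡ-sum; *-distribʳ-sum)
  open import Algebra.Solver.Ring.NaturalCoefficients.Default commutativeSemiring public
    using (solve; _:=_; _:+_; _:*_)

  open ≡-Reasoning

  ⁻¹-cancelˡ : ∀ {x} y → ¬ x ≡ 0# → (x ⁻¹) * (x * y) ≡ y
  ⁻¹-cancelˡ {x} y x≢0 = begin
    (x ⁻¹) * (x * y) ≡⟨ *-assoc _ _ _ ⟨
    (x ⁻¹) * x * y   ≡⟨ cong (_* y) (trans (*-comm _ _) (⁻¹-inverse x x≢0)) ⟩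
    1# * y           ≡⟨ *-identityˡ y ⟩
    y                ∎

  *-cancelˡ-nonzero : ∀ x {y z} → ¬ x ≡ 0# → x * y ≡ x * z → y ≡ z
  *-cancelˡ-nonzero x {y} {z} x≢0 eq =
    trans (sym (⁻¹-cancelˡ y x≢0)) (trans (cong ((x ⁻¹) *_) eq) (⁻¹-cancelˡ z x≢0))

  xy≡0⇒y≡0 : ∀ {x y} → ¬ x ≡ 0# → x * y ≡ 0# → y ≡ 0#
  xy≡0⇒y≡0 {x} x≢0 eq = *-cancelˡ-nonzero x x≢0 (trans eq (sym (zeroʳ x)))

  *-nonzero : ∀ {x y} → ¬ x ≡ 0# → ¬ y ≡ 0# → ¬ x * y ≡ 0#
  *-nonzero x≢0 y≢0 eq = y≢0 (xy≡0⇒y≡0 x≢0 eq)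

  xy≢0⇒x≢0 : ∀ {x y} → ¬ x * y ≡ 0# → ¬ x ≡ 0#
  xy≢0⇒x≢0 {y = y} xy≢0 refl = xy≢0 (zeroˡ y)

  xy≢0⇒y≢0 : ∀ {x y} → ¬ x * y ≡ 0# → ¬ y ≡ 0#
  xy≢0⇒y≢0 {x} xy≢0 refl = xy≢0 (zeroʳ x)

  ⁻¹-nonzero : ∀ {x} → ¬ x ≡ 0# → ¬ (x ⁻¹) ≡ 0#
  ⁻¹-nonzero {x} x≢0 eq = 0≢1 (trans (sym (zeroʳ x)) (trans (cong (x *_) (sym eq)) (⁻¹-inverse x x≢0)))

  1≢0 : ¬ 1# ≡ 0#
  1≢0 = 0≢1 ∘ sym

  ^-nonzero : ∀ {x} n → ¬ x ≡ 0# → ¬ x ^ n ≡ 0#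
  ^-nonzero zero    x≢0 = 1≢0
  ^-nonzero (suc n) x≢0 = *-nonzero x≢0 (^-nonzero n x≢0)

  ^-+ : ∀ x m n → x ^ (m ℕ.+ n) ≡ (x ^ m) * (x ^ n)
  ^-+ x zero    n = sym (*-identityˡ _)
  ^-+ x (suc m) n = trans (cong (x *_) (^-+ x m n)) (sym (*-assoc _ _ _))

  ^-*ˡ : ∀ x y n → (x * y) ^ n ≡ (x ^ n) * (y ^ n)
  ^-*ˡ x y zero    = sym (*-identityˡ _)
  ^-*ˡ x y (suc n) = trans (cong (x * y *_) (^-*ˡ x y n))
    (solve 4 (λ x y a b → (x :* y) :* (a :* b) := (x :* a) :* (y :* b)) refl x y (x ^ n) (y ^ n))

  1^n≡1 : ∀ n → 1# ^ n ≡ 1#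
  1^n≡1 zero    = refl
  1^n≡1 (suc n) = trans (*-identityˡ _) (1^n≡1 n)

  ^-* : ∀ x m n → x ^ (m ℕ.* n) ≡ (x ^ m) ^ n
  ^-* x zero    n = sym (1^n≡1 n)
  ^-* x (suc m) n = trans (^-+ x n (m ℕ.* n)) (trans (cong ((x ^ n) *_) (^-* x m n)) (sym (^-*ˡ x (x ^ m) n)))

  sum-zero : ∀ {n} (t : Fin n → Carrier) → (∀ i → t i ≡ 0#) → sum t ≡ 0#
  sum-zero {zero}  t t≡0 = refl
  sum-zero {suc n} t t≡0 =
    trans (cong₂ _+_ (t≡0 Fin.zero) (sum-zero (t ∘ Fin.suc) (t≡0 ∘ Fin.suc))) (+-identityˡ 0#)

  sum-single : ∀ {n} (t : Fin n → Carrier) j → (∀ i → ¬ i ≡ j → t i ≡ 0#) → sum t ≡ t j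
  sum-single t Fin.zero off =
    trans (cong (t Fin.zero +_) (sum-zero (t ∘ Fin.suc) (λ i → off (Fin.suc i) λ ()))) (+-identityʳ _)
  sum-single t (Fin.suc j) off =
    trans (cong₂ _+_ (off Fin.zero λ ()) (sum-single (t ∘ Fin.suc) j (λ i i≢j → off (Fin.suc i) (i≢j ∘ Finₚ.suc-injective))))
      (+-identityˡ _)

  -- Polynomials, Taylor expansions and zeros with multiplicity.

  -- Polynomials are coefficient sequences; Bounded D p says deg p < D.
  Poly : Set
  Poly = ℕ → Carrier

  Bounded : ℕ → Poly → Set
  Bounded D p = ∀ k → D ℕ.≤ k → p k ≡ 0#

  one : Poly
  one zero    = 1#
  one (suc _) = 0#

  shift : Poly → Poly
  shift p zero    = 0#
  shift p (suc k) = p k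

  -- lin b a p is the product (b + a z) p.
  lin : Carrier → Carrier → Poly → Poly
  lin b a p k = b * p k + a * shift p k

  shift-cong : ∀ {p p′} → (∀ k → p k ≡ p′ k) → ∀ k → shift p k ≡ shift p′ k
  shift-cong eq zero    = refl
  shift-cong eq (suc k) = eq k

  lin-cong : ∀ {b b′ a a′ p p′} → b ≡ b′ → a ≡ a′ → (∀ k → p k ≡ p′ k) → ∀ k → lin b a p k ≡ lin b′ a′ p′ k
  lin-cong refl refl eq k = cong₂ _+_ (*-congˡ (eq k)) (*-congˡ (shift-cong eq k))

  lin-bounded : ∀ {D} b a {p} → Bounded D p → Bounded (suc D) (lin b a p)
  lin-bounded b a bd (suc k) (s≤s D≤k) = trans
    (cong₂ _+_ (trans (cong (b *_) (bd (suc k) (ℕₚ.m≤n⇒m≤1+n D≤k))) (zeroʳ b)) (trans (cong (a *_) (bd k D≤k)) (zeroʳ a)))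
    (+-identityˡ 0#)

  -- (s + t) ^ d as a polynomial in t.
  translate : Carrier → ℕ → Poly
  translate s zero    = one
  translate s (suc d) = lin s 1# (translate s d)

  -- The coefficients in t of p (s + t), for deg p < D.
  taylor : Carrier → ℕ → Poly → Poly
  taylor s D p k = sum {D} (λ d → p (toℕ d) * translate s (toℕ d) k)

  taylor-cong : ∀ s D {p p′} → (∀ k → p k ≡ p′ k) → ∀ k → taylor s D p k ≡ taylor s D p′ k
  taylor-cong s D eq k = sum-cong-≗ {D} (λ d → cong (_* translate s (toℕ d) k) (eq (toℕ d)))

  sum-toℕ-last : ∀ D (t : ℕ → Carrier) → t D ≡ 0# → sum {suc D} (t ∘ toℕ) ≡ sum {D} (t ∘ toℕ)
  sum-toℕ-last zero    t eq = trans (+-identityʳ _) eq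
  sum-toℕ-last (suc D) t eq = cong (t 0 +_) (sum-toℕ-last D (t ∘ suc) eq)

  taylor-suc : ∀ s D p → p D ≡ 0# → ∀ k → taylor s (suc D) p k ≡ taylor s D p k
  taylor-suc s D p eq k = sum-toℕ-last D (λ d → p d * translate s d k) (trans (cong (_* translate s D k) eq) (zeroˡ _))

  taylor-mono : ∀ s {D p} → Bounded D p → ∀ e k → taylor s (e ℕ.+ D) p k ≡ taylor s D p k
  taylor-mono s bd zero    k = refl
  taylor-mono s {D} {p} bd (suc e) k = trans (taylor-suc s (e ℕ.+ D) p (bd (e ℕ.+ D) (ℕₚ.m≤n+m D e)) k) (taylor-mono s bd e k)

  taylor-shift : ∀ s D p k → sum {D} (λ d → p (toℕ d) * shift (translate s (toℕ d)) k) ≡ shift (taylor s D p) k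
  taylor-shift s D p zero    = sum-zero {D} _ (λ d → zeroʳ _)
  taylor-shift s D p (suc k) = refl

  -- At `z = s + t` the factor `b + a z` reads `(b + a s) + a t`. Expansions of products are
  -- obtained from this rule, one linear factor at a time.
  taylor-lin : ∀ s D b a {p} → Bounded D p → ∀ k →
    taylor s (suc D) (lin b a p) k ≡ lin (b + a * s) a (taylor s D p) k
  taylor-lin s D b a {p} bd k = begin
    sum {suc D} (λ d → lin b a p (toℕ d) * W (toℕ d))
      ≡⟨ sum-cong-≗ {suc D} (λ d → solve 5 (λ b x a y w → (b :* x :+ a :* y) :* w := b :* (x :* w) :+ a :* (y :* w)) refl b (p (toℕ d)) a (shift p (toℕ d)) (W (toℕ d))) ⟩
    sum {suc D} (λ d → b * (p (toℕ d) * W (toℕ d)) + a * (shift p (toℕ d) * W (toℕ d)))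
      ≡⟨ ∑-distrib-+ {suc D} (λ d → b * (p (toℕ d) * W (toℕ d))) (λ d → a * (shift p (toℕ d) * W (toℕ d))) ⟩
    sum {suc D} (λ d → b * (p (toℕ d) * W (toℕ d))) + sum {suc D} (λ d → a * (shift p (toℕ d) * W (toℕ d)))
      ≡⟨ cong₂ _+_ (*-distribˡ-sum {suc D} b (λ d → p (toℕ d) * W (toℕ d))) (*-distribˡ-sum {suc D} a (λ d → shift p (toℕ d) * W (toℕ d))) ⟨
    b * taylor s (suc D) p k + a * (0# * W 0 + sum {D} (λ d → p (toℕ d) * W (suc (toℕ d))))
      ≡⟨ cong₂ (λ x y → b * x + a * y) (taylor-suc s D p (bd D ℕₚ.≤-refl) k) (trans (cong₂ _+_ (zeroˡ _) shifted) (+-identityˡ _)) ⟩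
    b * T + a * (s * T + T′)
      ≡⟨ solve 5 (λ b a s x y → b :* x :+ a :* (s :* x :+ y) := (b :+ a :* s) :* x :+ a :* y) refl b a s T T′ ⟩
    (b + a * s) * T + a * T′ ∎
    where
    W : ℕ → Carrier
    W d = translate s d k
    T = taylor s D p k
    T′ = shift (taylor s D p) k
    shifted : sum {D} (λ d → p (toℕ d) * W (suc (toℕ d))) ≡ s * T + T′
    shifted = begin
      sum {D} (λ d → p (toℕ d) * W (suc (toℕ d)))
        ≡⟨ sum-cong-≗ {D} (λ d → trans (cong (λ y → p (toℕ d) * (s * W (toℕ d) + y)) (*-identityˡ _))
             (solve 4 (λ x s w v → x :* (s :* w :+ v) := s :* (x :* w) :+ x :* v) refl (p (toℕ d)) s (W (toℕ d)) (shift (translate s (toℕ d)) k))) ⟩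
      sum {D} (λ d → s * (p (toℕ d) * W (toℕ d)) + p (toℕ d) * shift (translate s (toℕ d)) k)
        ≡⟨ ∑-distrib-+ {D} (λ d → s * (p (toℕ d) * W (toℕ d))) _ ⟩
      sum {D} (λ d → s * (p (toℕ d) * W (toℕ d))) + sum {D} (λ d → p (toℕ d) * shift (translate s (toℕ d)) k)
        ≡⟨ cong₂ _+_ (sym (*-distribˡ-sum {D} s _)) (taylor-shift s D p k) ⟩
      s * T + T′ ∎

  eval : Carrier → ℕ → Poly → Carrier
  eval s D p = taylor s D p 0

  eval-suc : ∀ s D p → eval s (suc D) p ≡ p 0 + s * eval s D (p ∘ suc)
  eval-suc s D p = cong₂ _+_ (*-identityʳ _) (trans
    (sum-cong-≗ {D} (λ d → trans (cong (p (suc (toℕ d)) *_) (trans (cong (s * translate s (toℕ d) 0 +_) (zeroʳ 1#)) (+-identityʳ _)))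
      (solve 3 (λ x s w → x :* (s :* w) := s :* (x :* w)) refl (p (suc (toℕ d))) s (translate s (toℕ d) 0))))
    (sym (*-distribˡ-sum {D} s _)))

  eval-≡0-factor : ∀ s D {p} → Bounded (suc D) p → eval s (suc D) p ≡ 0# →
    ∃[ r ] (Bounded D r × ∀ k → p k ≡ lin (- s) 1# r k)
  eval-≡0-factor s D {p} bd root = r , r-bounded , factor
    where
    r : Poly
    -- Synthetic division: the quotient by `z - s` has the Horner tails
    -- `p (k + 1) + p (k + 2) s + ...` as coefficients.
    r k = eval s D (λ i → p (suc (k ℕ.+ i)))
    r-bounded : Bounded D r
    r-bounded k D≤k = sum-zero {D} _ (λ d → trans (*-congʳ (bd _ (s≤s (ℕₚ.≤-trans D≤k (ℕₚ.m≤m+n k _))))) (zeroˡ _))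
    r-step : ∀ k → r k ≡ p (suc k) + s * r (suc k)
    r-step k = begin
      r k ≡⟨ taylor-suc s D (λ i → p (suc (k ℕ.+ i))) (bd _ (s≤s (ℕₚ.m≤n+m D k))) 0 ⟨
      eval s (suc D) (λ i → p (suc (k ℕ.+ i))) ≡⟨ eval-suc s D (λ i → p (suc (k ℕ.+ i))) ⟩
      p (suc (k ℕ.+ 0)) + s * eval s D (λ i → p (suc (k ℕ.+ suc i)))
        ≡⟨ cong₂ (λ x y → x + s * y) (cong (p ∘ suc) (ℕₚ.+-identityʳ k)) (taylor-cong s D (λ i → cong (p ∘ suc) (ℕₚ.+-suc k i)) 0) ⟩
      p (suc k) + s * r (suc k) ∎
    -s*x : ∀ x → - s * x ≡ - (s * x)
    -s*x x = sym (-‿distribˡ-* s x)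
    factor : ∀ k → p k ≡ lin (- s) 1# r k
    factor zero = begin
      p 0 ≡⟨ +-inverseʳ-unique (s * r 0) (p 0) (trans (+-comm _ _) (trans (sym (eval-suc s D p)) root)) ⟩
      - (s * r 0) ≡⟨ -s*x _ ⟨
      - s * r 0 ≡⟨ +-identityʳ _ ⟨
      - s * r 0 + 0# ≡⟨ +-congˡ (zeroʳ 1#) ⟨
      lin (- s) 1# r 0 ∎
    factor (suc k) = sym (begin
      - s * r (suc k) + 1# * r k ≡⟨ cong₂ _+_ (-s*x _) (*-identityˡ _) ⟩
      - (s * r (suc k)) + r k ≡⟨ +-congˡ (trans (r-step k) (+-comm _ _)) ⟩
      - (s * r (suc k)) + (s * r (suc k) + p (suc k)) ≡⟨ +-assoc _ _ _ ⟨
      - (s * r (suc k)) + s * r (suc k) + p (suc k) ≡⟨ cong (_+ p (suc k)) (-‿inverseˡ _) ⟩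
      0# + p (suc k) ≡⟨ +-identityˡ _ ⟩
      p (suc k) ∎)

  VanishesAt : ℕ → Poly → Carrier × ℕ → Set
  VanishesAt D p (s , M) = ∀ k → k ℕ.< M → taylor s D p k ≡ 0#

  -- Splitting off one factor `z - s` lowers the degree bound by one and costs one unit of
  -- multiplicity at `s` only. Multiplicity is measured by Taylor coefficients, so the count is
  -- valid in every characteristic.
  roots-bound : ∀ D (roots : List (Carrier × ℕ)) {p} → Bounded D p →
    AllPairs (λ x y → ¬ proj₁ x ≡ proj₁ y) roots → All (VanishesAt D p) roots →
    D ℕ.≤ sum-ℕ (map proj₂ roots) → ∀ k → p k ≡ 0#
  roots-bound zero roots bd _ _ _ k = bd k z≤n
  roots-bound (suc D) ((s , zero) ∷ roots) bd (_ ∷ distinct) (_ ∷ vanish) D≤ = roots-bound (suc D) roots bd distinct vanish D≤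
  roots-bound (suc D) ((s , suc M) ∷ roots) {p} bd (s∉ ∷ distinct) (v ∷ vanish) (s≤s D≤)
    with r , r-bounded , p≡ ← eval-≡0-factor s D bd (v 0 (s≤s z≤n)) = λ k →
      trans (p≡ k) (trans (lin-cong {p′ = λ _ → 0#} refl refl r≡0 k) (trans (cong₂ _+_ (zeroʳ _) (trans (cong (1# *_) (shift-0 k)) (zeroʳ _))) (+-identityˡ 0#)))
    where
    shift-0 : ∀ k → shift (λ _ → 0#) k ≡ 0#
    shift-0 zero    = refl
    shift-0 (suc k) = refl
    taylor-p : ∀ s′ k → taylor s′ (suc D) p k ≡ lin (- s + 1# * s′) 1# (taylor s′ D r) k
    taylor-p s′ k = trans (taylor-cong s′ (suc D) p≡ k) (taylor-lin s′ D (- s) 1# r-bounded k)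
    -- At `s` itself the removed factor is just `t`, so the expansion of `p` is that of `r` shifted
    -- by one place.
    at-s : ∀ k → k ℕ.< M → taylor s D r k ≡ 0#
    at-s k k<M = begin
      taylor s D r k                          ≡⟨ *-identityˡ _ ⟨
      1# * taylor s D r k                     ≡⟨ +-identityˡ _ ⟨
      0# + 1# * taylor s D r k                ≡⟨ +-congʳ (zeroˡ _) ⟨
      0# * taylor s D r (suc k) + 1# * taylor s D r k
        ≡⟨ cong (λ x → x * taylor s D r (suc k) + 1# * taylor s D r k) (trans (cong (- s +_) (*-identityˡ s)) (-‿inverseˡ s)) ⟨
      lin (- s + 1# * s) 1# (taylor s D r) (suc k) ≡⟨ taylor-p s (suc k) ⟨
      taylor s (suc D) p (suc k)              ≡⟨ v (suc k) (s≤s k<M) ⟩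
      0# ∎
    -- Elsewhere the removed factor is `δ + t` with `δ = s′ - s` invertible, so vanishing passes
    -- from `p` to `r` coefficient by coefficient.
    away : ∀ s′ M′ → ¬ s ≡ s′ → VanishesAt (suc D) p (s′ , M′) → VanishesAt D r (s′ , M′)
    away s′ M′ s≢s′ v′ k k<M′ = xy≡0⇒y≡0 δ≢0 (begin
      δ * taylor s′ D r k                      ≡⟨ +-identityʳ _ ⟨
      δ * taylor s′ D r k + 0#                 ≡⟨ +-congˡ (trans (*-identityˡ _) (previous k k<M′)) ⟨
      δ * taylor s′ D r k + 1# * shift (taylor s′ D r) k ≡⟨ taylor-p s′ k ⟨
      taylor s′ (suc D) p k                    ≡⟨ v′ k k<M′ ⟩
      0# ∎)
      where
      δ = - s + 1# * s′
      δ≢0 : ¬ δ ≡ 0#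
      δ≢0 eq = s≢s′ (sym (x-y≡0⇒x≡y s′ s (trans (+-comm _ _) (trans (cong (- s +_) (sym (*-identityˡ s′))) eq))))
      previous : ∀ k → k ℕ.< M′ → shift (taylor s′ D r) k ≡ 0#
      previous zero    _   = refl
      previous (suc k) k<  = away s′ M′ s≢s′ v′ k (ℕₚ.<-trans (ℕₚ.n<1+n k) k<)
    r≡0 : ∀ k → r k ≡ 0#
    r≡0 = roots-bound D ((s , M) ∷ roots) r-bounded (s∉ ∷ distinct)
      (at-s ∷ All.zipWith (λ { (s≢s′ , v′) → away _ _ s≢s′ v′ }) (s∉ , vanish)) D≤

-- Stepanov's method: linear algebra over the field and polynomial dependence on the base point.

module Stepanov (F : FiniteField) where

  open FiniteField F
  open FieldProperties F

  open ≡-Reasoning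

  to : Fin q → Carrier
  to = Inverse.to enumeration

  from : Carrier → Fin q
  from = Inverse.from enumeration

  to-from : ∀ x → to (from x) ≡ x
  to-from x = Inverse.inverseˡ enumeration refl

  from-to : ∀ i → from (to i) ≡ i
  from-to i = Inverse.inverseʳ enumeration refl

  to-injective : ∀ {i j} → to i ≡ to j → i ≡ j
  to-injective {i} {j} eq = trans (sym (from-to i)) (trans (cong from eq) (from-to j))

  from-injective : ∀ {x y} → from x ≡ from y → x ≡ y
  from-injective {x} {y} eq = trans (sym (to-from x)) (trans (cong to eq) (to-from y))

  1<q : 1 ℕ.< q
  1<q = Finₚ.injective⇒≤ {f = two} two-injective
    where
    two : Fin 2 → Fin q
    two Fin.zero    = from 0#
    two (Fin.suc _) = from 1#
    two-injective : ∀ {i j} → two i ≡ two j → i ≡ j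
    two-injective {Fin.zero}         {Fin.zero}         _  = refl
    two-injective {Fin.zero}         {Fin.suc _}        eq = contradiction (from-injective eq) 0≢1
    two-injective {Fin.suc _}        {Fin.zero}         eq = contradiction (sym (from-injective eq)) 0≢1
    two-injective {Fin.suc Fin.zero} {Fin.suc Fin.zero} _  = refl

  dot : ∀ {n} → (Fin n → Carrier) → (Fin n → Carrier) → Carrier
  dot h v = sum (λ e → h e * v e)

  dot-difference : ∀ {n} (h h′ v : Fin n → Carrier) → dot h v ≡ dot h′ v → dot (λ e → h e + - h′ e) v ≡ 0#
  dot-difference h h′ v eq = +-cancelˡ (dot h′ v) _ _ (begin
    dot h′ v + dot (λ e → h e + - h′ e) v       ≡⟨ ∑-distrib-+ (λ e → h′ e * v e) _ ⟨
    sum (λ e → h′ e * v e + (h e + - h′ e) * v e) ≡⟨ sum-cong-≗ (λ e → trans (sym (distribʳ (v e) (h′ e) _)) (cong (_* v e) (restore e))) ⟩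
    dot h v                                     ≡⟨ eq ⟩
    dot h′ v                                    ≡⟨ +-identityʳ _ ⟨
    dot h′ v + 0# ∎)
    where
    restore : ∀ e → h′ e + (h e + - h′ e) ≡ h e
    restore e = trans (solve 3 (λ x y z → x :+ (y :+ z) := y :+ (x :+ z)) refl (h′ e) (h e) (- h′ e))
      (trans (+-congˡ (-‿inverseʳ (h′ e))) (+-identityʳ _))

  dot-swap : ∀ {n} d (h : Fin n → Carrier) (a : Fin n → Fin d → Carrier) (w : Fin d → Carrier) →
    dot h (λ e → sum {d} (λ i → a e i * w i)) ≡ sum {d} (λ i → dot h (λ e → a e i) * w i)
  dot-swap {n} d h a w = begin
    sum {n} (λ e → h e * sum {d} (λ i → a e i * w i))
      ≡⟨ sum-cong-≗ {n} (λ e → trans (*-distribˡ-sum {d} (h e) (λ i → a e i * w i)) (sum-cong-≗ {d} (λ i → sym (*-assoc (h e) (a e i) (w i))))) ⟩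
    sum {n} (λ e → sum {d} (λ i → h e * a e i * w i))
      ≡⟨ ∑-comm (λ e i → h e * a e i * w i) ⟩
    sum {d} (λ i → sum {n} (λ e → h e * a e i * w i))
      ≡⟨ sum-cong-≗ {d} (λ i → *-distribʳ-sum {n} (w i) (λ e → h e * a e i)) ⟨
    sum {d} (λ i → dot h (λ e → a e i) * w i) ∎

  -- Two of the q ^ n vectors have the same image in the q ^ k possible values.
  kernel : ∀ {n k} (v : Fin k → Fin n → Carrier) → k ℕ.< n →
    ∃[ h ] (¬ (∀ e → h e ≡ 0#) × ∀ c → dot h (v c) ≡ 0#)
  kernel {n} {k} v k<n
    with i , j , i<j , images≡ ← Finₚ.pigeonhole (ℕₚ.^-monoʳ-< q 1<q k<n) (λ i → Fin.funToFin (λ c → from (dot (λ e → to (Fin.finToFun {q} {n} i e)) (v c))))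
    = (λ e → vec i e + - vec j e) , nonzero , λ c → dot-difference (vec i) (vec j) (v c) (dots≡ c)
    where
    vec : Fin (q ℕ.^ n) → Fin n → Carrier
    vec i e = to (Fin.finToFun i e)
    dots≡ : ∀ c → dot (vec i) (v c) ≡ dot (vec j) (v c)
    dots≡ c = from-injective (trans (sym (Finₚ.finToFun-funToFin _ c))
      (trans (cong (λ x → Fin.finToFun x c) images≡) (Finₚ.finToFun-funToFin _ c)))
    funToFin-cong : ∀ {m o} {f g : Fin m → Fin o} → (∀ e → f e ≡ g e) → Fin.funToFin f ≡ Fin.funToFin g
    funToFin-cong {zero}  eq = refl
    funToFin-cong {suc m} eq = cong₂ Fin.combine (eq Fin.zero) (funToFin-cong (eq ∘ Fin.suc))
    nonzero : ¬ (∀ e → vec i e + - vec j e ≡ 0#)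
    nonzero eq = Finₚ.<-irrefl (trans (sym (Finₚ.funToFin-finToFin {n} {q} i))
      (trans (funToFin-cong (λ e → to-injective (x-y≡0⇒x≡y _ _ (eq e)))) (Finₚ.funToFin-finToFin {n} {q} j))) i<j

  -- The point is the number of coefficients: `d` linear conditions suffice to make a linear
  -- combination of such functions vanish at every `s` at once.
  PolyFun : ℕ → (Carrier → Carrier) → Set
  PolyFun d g = ∃[ p ] (Bounded d p × ∀ s → g s ≡ eval s d p)

  polyFun-cong : ∀ {d g g′} → (∀ s → g s ≡ g′ s) → PolyFun d g′ → PolyFun d g
  polyFun-cong eq (p , bd , ev) = p , bd , λ s → trans (eq s) (ev s)

  polyFun-mono : ∀ {d d′ g} → d ℕ.≤ d′ → PolyFun d g → PolyFun d′ g
  polyFun-mono {d} {d′} {g} d≤d′ (p , bd , ev) = p , (λ k d′≤k → bd k (ℕₚ.≤-trans d≤d′ d′≤k)) ,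
    λ s → trans (ev s) (trans (sym (taylor-mono s bd (d′ ℕ.∸ d) 0)) (cong (λ D → eval s D p) (ℕₚ.m∸n+n≡m d≤d′)))

  polyFun-linear : ∀ {d g} a b → PolyFun d g → PolyFun (suc d) (λ s → (a * s + b) * g s)
  polyFun-linear {d} {g} a b (p , bd , ev) = lin b a p , lin-bounded b a bd , λ s → begin
    (a * s + b) * g s                 ≡⟨ cong₂ _*_ (+-comm _ b) (ev s) ⟩
    (b + a * s) * eval s d p          ≡⟨ +-identityʳ _ ⟨
    (b + a * s) * eval s d p + 0#     ≡⟨ +-congˡ (zeroʳ a) ⟨
    lin (b + a * s) a (taylor s d p) 0 ≡⟨ taylor-lin s d b a bd 0 ⟨
    eval s (suc d) (lin b a p) ∎

  polyFun-+ : ∀ {d g g′} → PolyFun d g → PolyFun d g′ → PolyFun d (λ s → g s + g′ s)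
  polyFun-+ {d} (p , bd , ev) (p′ , bd′ , ev′) =
    (λ k → p k + p′ k) , (λ k d≤k → trans (cong₂ _+_ (bd k d≤k) (bd′ k d≤k)) (+-identityˡ 0#)) ,
    λ s → trans (cong₂ _+_ (ev s) (ev′ s)) (trans (sym (∑-distrib-+ {d} (λ i → p (toℕ i) * translate s (toℕ i) 0) (λ i → p′ (toℕ i) * translate s (toℕ i) 0)))
      (sum-cong-≗ {d} (λ i → sym (distribʳ _ (p (toℕ i)) (p′ (toℕ i))))))

  polyFun-scale : ∀ {d g} a → PolyFun d g → PolyFun d (λ s → a * g s)
  polyFun-scale {d} a (p , bd , ev) = (λ k → a * p k) , (λ k d≤k → trans (*-congˡ (bd k d≤k)) (zeroʳ a)) ,
    λ s → trans (*-congˡ (ev s)) (trans (*-distribˡ-sum {d} a (λ i → p (toℕ i) * translate s (toℕ i) 0))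
      (sum-cong-≗ {d} (λ i → sym (*-assoc a (p (toℕ i)) _))))

  polyFun-id* : ∀ {d g} → PolyFun d g → PolyFun (suc d) (λ s → s * g s)
  polyFun-id* {g = g} pf = polyFun-cong (λ s → cong (_* g s) (sym (trans (+-identityʳ _) (*-identityˡ s)))) (polyFun-linear 1# 0# pf)

  polyFun-^* : ∀ {d g} i → PolyFun d g → PolyFun (i ℕ.+ d) (λ s → (s ^ i) * g s)
  polyFun-^* zero    pf = polyFun-cong (λ s → *-identityˡ _) pf
  polyFun-^* (suc i) pf = polyFun-cong (λ s → *-assoc s _ _) (polyFun-id* (polyFun-^* i pf))

  -- Degree at most `2 k` at order `k`: each factor `1 + c(s) τ` has `c` of degree at most 2,
  -- whatever the number of factors. This makes the cost of a zero independent of the exponents.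
  PolySeries : (Carrier → ℕ → Carrier) → Set
  PolySeries G = ∀ k → PolyFun (suc (k ℕ.+ k)) (λ s → G s k)

  -- Multiplication by 1 + c(s) τ with c a product of two linear functions of s.
  polySeries-lin : ∀ {G} {c : Carrier → Carrier} → (∀ {d g} → PolyFun d g → PolyFun (suc (suc d)) (λ s → c s * g s)) →
    PolySeries G → PolySeries (λ s → lin 1# (c s) (G s))
  polySeries-lin {G} {c} c* pf zero    = polyFun-cong (λ s → trans (cong₂ _+_ (*-identityˡ _) (zeroʳ _)) (+-identityʳ _)) (pf 0)
  polySeries-lin {G} {c} c* pf (suc k) = polyFun-cong (λ s → +-congʳ (*-identityˡ _))
    (polyFun-+ (pf (suc k)) (subst (λ d → PolyFun d (λ s → c s * G s k)) (cong (suc ∘ suc) (sym (ℕₚ.+-suc k k))) (c* (pf k))))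

  polySeries-fold : ∀ {G} (c : Carrier → Carrier) n → (∀ {d g} → PolyFun d g → PolyFun (suc (suc d)) (λ s → c s * g s)) →
    PolySeries G → PolySeries (λ s → fold (G s) (lin 1# (c s)) n)
  polySeries-fold c zero    c* pf = pf
  polySeries-fold c (suc n) c* pf = polySeries-lin {c = c} c* (polySeries-fold c n c* pf)

  polySeries-one : PolySeries (λ _ → one)
  polySeries-one k = (λ { zero → one k ; (suc _) → 0# }) , (λ { (suc _) _ → refl }) ,
    λ s → sym (trans (cong₂ _+_ (*-identityʳ _) (sum-zero {k ℕ.+ k} _ (λ d → zeroˡ _))) (+-identityʳ _))

  -- c P ^ k = C G k for all k: after the substitution t = P τ, the series c becomes C G.
  Rescaled : Carrier → Carrier → Poly → Poly → Set
  Rescaled P C c G = ∀ k → c k * (P ^ k) ≡ C * G k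

  -- The factor `x + a t` becomes `x + a P τ = x (1 + g τ)`: its value `x` joins the constant `C`,
  -- and only `1 + g τ` enters the series.
  rescaled-lin : ∀ {P C c G} x a g → a * P ≡ x * g → Rescaled P C c G → Rescaled P (x * C) (lin x a c) (lin 1# g G)
  rescaled-lin {P} {C} {c} {G} x a g aP≡xg sc zero = begin
    (x * c 0 + a * 0#) * 1#   ≡⟨ *-identityʳ _ ⟩
    x * c 0 + a * 0#          ≡⟨ trans (+-congˡ (zeroʳ a)) (+-identityʳ _) ⟩
    x * c 0                   ≡⟨ *-congˡ (trans (sym (*-identityʳ _)) (sc 0)) ⟩
    x * (C * G 0)             ≡⟨ *-assoc _ _ _ ⟨
    x * C * G 0               ≡⟨ *-congˡ (trans (cong₂ _+_ (*-identityˡ _) (zeroʳ g)) (+-identityʳ _)) ⟨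
    x * C * lin 1# g G 0 ∎
  rescaled-lin {P} {C} {c} {G} x a g aP≡xg sc (suc k) = begin
    (x * c (suc k) + a * c k) * (P * (P ^ k))
      ≡⟨ solve 6 (λ x c a d p r → (x :* c :+ a :* d) :* (p :* r) := x :* (c :* (p :* r)) :+ (a :* p) :* (d :* r)) refl x (c (suc k)) a (c k) P (P ^ k) ⟩
    x * (c (suc k) * (P * (P ^ k))) + (a * P) * (c k * (P ^ k))
      ≡⟨ cong₂ _+_ (*-congˡ (sc (suc k))) (cong₂ _*_ aP≡xg (sc k)) ⟩
    x * (C * G (suc k)) + (x * g) * (C * G k)
      ≡⟨ solve 5 (λ x C G g H → x :* (C :* G) :+ (x :* g) :* (C :* H) := (x :* C) :* (G :+ g :* H)) refl x C (G (suc k)) g (G k) ⟩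
    x * C * (G (suc k) + g * G k)
      ≡⟨ *-congˡ (+-congʳ (*-identityˡ _)) ⟨
    x * C * lin 1# g G (suc k) ∎

  rescaled-fold : ∀ {P C c G} x a g n → a * P ≡ x * g → Rescaled P C c G →
    Rescaled P ((x ^ n) * C) (fold c (lin x a) n) (fold G (lin 1# g) n)
  rescaled-fold x a g zero    eq sc k = trans (sc k) (*-congʳ (sym (*-identityˡ _)))
  rescaled-fold x a g (suc n) eq sc k = trans (rescaled-lin x a g eq (rescaled-fold x a g n eq sc) k) (*-congʳ (sym (*-assoc x _ _)))

  -- Expansion of products of powers of three linear forms.

  module Products (a₁ b₁ a₂ b₂ : Carrier) where

    X Y : Carrier → Carrier
    X s = a₁ * s + b₁
    Y s = a₂ * s + b₂

    -- z ^ e * X z ^ u * Y z ^ w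
    product : ℕ → ℕ → ℕ → Poly
    product e u w = fold (fold (fold one (lin b₂ a₂) w) (lin b₁ a₁) u) (lin 0# 1#) e

    fold-bounded : ∀ {D p} b a n → Bounded D p → Bounded (n ℕ.+ D) (fold p (lin b a) n)
    fold-bounded b a zero    bd = bd
    fold-bounded b a (suc n) bd = lin-bounded b a (fold-bounded b a n bd)

    one-bounded : Bounded 1 one
    one-bounded (suc _) _ = refl

    fold-taylor : ∀ s {D p c} b a n → Bounded D p → (∀ k → taylor s D p k ≡ c k) →
      ∀ k → taylor s (n ℕ.+ D) (fold p (lin b a) n) k ≡ fold c (lin (b + a * s) a) n k
    fold-taylor s b a zero    bd eq k = eq k
    fold-taylor s {D} b a (suc n) bd eq k =
      trans (taylor-lin s (n ℕ.+ D) b a (fold-bounded b a n bd) k) (lin-cong refl refl (fold-taylor s b a n bd eq) k)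

    product-bounded : ∀ e u w → Bounded (e ℕ.+ (u ℕ.+ (w ℕ.+ 1))) (product e u w)
    product-bounded e u w = fold-bounded 0# 1# e (fold-bounded b₁ a₁ u (fold-bounded b₂ a₂ w one-bounded))

    -- With `t = P τ` and `P = s X(s) Y(s)`, the forms `z`, `X z`, `Y z` are `s`, `X s`, `Y s` times
    -- `1 + X Y τ`, `1 + a₁ s Y τ`, `1 + a₂ s X τ`. Taking `P` to be the product of all three values
    -- is what leaves no denominators.
    rescaled-series : ℕ → ℕ → ℕ → Carrier → Poly
    rescaled-series e u w s = fold (fold (fold one (lin 1# (a₂ * (s * X s))) w) (lin 1# (a₁ * (s * Y s))) u) (lin 1# (X s * Y s)) e

    rescaled-series-poly : ∀ e u w → PolySeries (rescaled-series e u w)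
    rescaled-series-poly e u w =
      polySeries-fold (λ s → X s * Y s) e (λ pf → polyFun-cong (λ s → *-assoc _ _ _) (polyFun-linear a₁ b₁ (polyFun-linear a₂ b₂ pf)))
        (polySeries-fold (λ s → a₁ * (s * Y s)) u (λ pf → polyFun-cong (λ s → reassoc a₁ s (Y s) _) (polyFun-scale a₁ (polyFun-id* (polyFun-linear a₂ b₂ pf))))
          (polySeries-fold (λ s → a₂ * (s * X s)) w (λ pf → polyFun-cong (λ s → reassoc a₂ s (X s) _) (polyFun-scale a₂ (polyFun-id* (polyFun-linear a₁ b₁ pf))))
            polySeries-one))
      where
      reassoc : ∀ a s x g → a * (s * x) * g ≡ a * (s * (x * g))
      reassoc = solve 4 (λ a s x g → a :* (s :* x) :* g := a :* (s :* (x :* g))) refl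

    value : ℕ → ℕ → ℕ → Carrier → Carrier
    value e u w s = (s ^ e) * ((X s ^ u) * ((Y s ^ w) * 1#))

    product-rescaled : ∀ e u w s →
      Rescaled (s * (X s * Y s)) (value e u w s) (taylor s (e ℕ.+ (u ℕ.+ (w ℕ.+ 1))) (product e u w)) (rescaled-series e u w s)
    product-rescaled e u w s k = trans (*-congʳ (taylor-product k))
      (rescaled-fold s 1# (X s * Y s) e (*-identityˡ _)
        (rescaled-fold (X s) a₁ (a₁ * (s * Y s)) u (swap-X a₁ s (X s) (Y s))
          (rescaled-fold (Y s) a₂ (a₂ * (s * X s)) w (swap-Y a₂ s (X s) (Y s)) (λ k → refl-one k)))
        k)
      where
      P = s * (X s * Y s)
      swap-X : ∀ a s x y → a * (s * (x * y)) ≡ x * (a * (s * y))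
      swap-X = solve 4 (λ a s x y → a :* (s :* (x :* y)) := x :* (a :* (s :* y))) refl
      swap-Y : ∀ a s x y → a * (s * (x * y)) ≡ y * (a * (s * x))
      swap-Y = solve 4 (λ a s x y → a :* (s :* (x :* y)) := y :* (a :* (s :* x))) refl
      refl-one : Rescaled P 1# one one
      refl-one zero    = refl
      refl-one (suc k) = trans (zeroˡ _) (sym (zeroʳ 1#))
      c₀ : ∀ k → taylor s 1 one k ≡ one k
      c₀ k = trans (+-identityʳ _) (*-identityˡ _)
      fold-cong : ∀ {p b b′ a} n → b ≡ b′ → ∀ k → fold p (lin b a) n k ≡ fold p (lin b′ a) n k
      fold-cong n refl k = refl
      taylor-product : ∀ k → taylor s (e ℕ.+ (u ℕ.+ (w ℕ.+ 1))) (product e u w) k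
        ≡ fold (fold (fold one (lin (Y s) a₂) w) (lin (X s) a₁) u) (lin s 1#) e k
      taylor-product k = trans
        (fold-taylor s 0# 1# e (fold-bounded b₁ a₁ u (fold-bounded b₂ a₂ w one-bounded))
          (λ k → trans (fold-taylor s b₁ a₁ u (fold-bounded b₂ a₂ w one-bounded)
            (λ k → trans (fold-taylor s b₂ a₂ w one-bounded c₀ k) (fold-cong w (+-comm _ _) k)) k)
            (fold-cong u (+-comm _ _) k)) k)
        (fold-cong e (trans (+-identityˡ _) (*-identityˡ s)) k)

    product-low : ∀ e u w {k} → k ℕ.< e → product e u w k ≡ 0#
    product-low (suc e) u w {zero}  k<e       = trans (cong₂ _+_ (zeroˡ _) (*-identityˡ _)) (+-identityˡ _)
    product-low (suc e) u w {suc k} (s≤s k<e) =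
      trans (cong₂ _+_ (zeroˡ _) (trans (*-identityˡ _) (product-low e u w k<e))) (+-identityˡ _)

    -- This coefficient is `b₁ ^ u` times `b₂ ^ w`.
    product-leading : ∀ e u w → ¬ b₁ ≡ 0# → ¬ b₂ ≡ 0# → ¬ product e u w e ≡ 0#
    product-leading zero u w b₁≢0 b₂≢0 = constant u b₁≢0 (constant w b₂≢0 1≢0)
      where
      constant : ∀ {p b a} n → ¬ b ≡ 0# → ¬ p 0 ≡ 0# → ¬ fold p (lin b a) n 0 ≡ 0#
      constant zero    b≢0 p≢0 = p≢0
      constant (suc n) b≢0 p≢0 eq =
        *-nonzero b≢0 (constant n b≢0 p≢0) (trans (sym (trans (+-congˡ (zeroʳ _)) (+-identityʳ _))) eq)
    product-leading (suc e) u w b₁≢0 b₂≢0 eq =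
      product-leading e u w b₁≢0 b₂≢0 (trans (sym (trans (cong₂ _+_ (zeroˡ _) (*-identityˡ _)) (+-identityˡ _))) eq)

    OnCurve : (m g : ℕ) → Carrier → Carrier → Set
    OnCurve m g κ s = ¬ s ≡ 0# × ¬ X s ≡ 0# × ¬ Y s ≡ 0# × (s ^ m) * (X s ^ (m ℕ.* g)) ≡ κ * (Y s ^ m)

    -- The auxiliary polynomial.

    module AuxiliaryPolynomial (Q m ℓ : ℕ) .{{_ : ℕ.NonZero m}} .{{_ : ℕ.NonZero ℓ}} (Q≡ : Q ≡ ℓ ℕ.* m) (^Q≡1 : ∀ {x} → ¬ x ≡ 0# → x ^ Q ≡ 1#)
      (b₁≢0 : ¬ b₁ ≡ 0#) (b₂≢0 : ¬ b₂ ≡ 0#) (g : ℕ) (κ : Carrier) where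

      D : ℕ
      D = Q ℕ.+ Q

      block rem : ℕ → ℕ
      block e = e DivMod./ m
      rem e = e DivMod.% m

      -- These exponents make B e equal to κ ^ block e * s ^ (e % m) at every s on the curve.
      u w : ℕ → ℕ
      u e = m ℕ.* ((g ℕ.* block e) DivMod.% ℓ)
      w e = m ℕ.* (ℓ ℕ.∸ block e)

      B : ℕ → Poly
      B e = product e (u e) (w e)

      block≤ℓ : ∀ {e} → e ℕ.< Q → block e ℕ.≤ ℓ
      block≤ℓ e<Q = ℕₚ.<⇒≤ (DivMod.m<n*o⇒m/o<n (subst (_ ℕ.<_) Q≡ e<Q))

      -- The three exponents satisfy `e < m (block e + 1)`, `u e ≤ m (ℓ - 1)` and
      -- `w e = m (ℓ - block e)`. The block number cancels and `2 m ℓ` remains.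
      degree≤ : ∀ {e} → e ℕ.< Q → e ℕ.+ (u e ℕ.+ (w e ℕ.+ 1)) ℕ.≤ D
      degree≤ {e} e<Q = ℕₚ.≤-trans (ℕₚ.≤-reflexive (rearrange e (u e) (w e)))
        (ℕₚ.≤-trans (ℕₚ.+-monoˡ-≤ (w e) (ℕₚ.+-mono-≤ e< u≤)) (ℕₚ.≤-reflexive total))
        where
        open NatSolver.+-*-Solver renaming (solve to solveℕ; _:+_ to _⊕_; _:=_ to _⊜_; con to conℕ; _:*_ to _⊗_)
        rearrange : ∀ e u w → e ℕ.+ (u ℕ.+ (w ℕ.+ 1)) ≡ (suc e ℕ.+ u) ℕ.+ w
        rearrange = solveℕ 3 (λ e u w → e ⊕ (u ⊕ (w ⊕ conℕ 1)) ⊜ (conℕ 1 ⊕ e ⊕ u) ⊕ w) refl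
        e< : suc e ℕ.≤ m ℕ.* block e ℕ.+ m
        e< = ℕₚ.≤-trans (s≤s (ℕₚ.≤-reflexive (DivMod.m≡m%n+[m/n]*n e m)))
          (ℕₚ.≤-trans (ℕₚ.+-monoˡ-≤ _ (DivMod.m%n<n e m)) (ℕₚ.≤-reflexive (trans (ℕₚ.+-comm m _) (cong (ℕ._+ m) (ℕₚ.*-comm (block e) m)))))
        u≤ : u e ℕ.≤ m ℕ.* (ℓ ℕ.∸ 1)
        u≤ = ℕₚ.*-monoʳ-≤ m (ℕₚ.∸-monoˡ-≤ 1 (DivMod.m%n<n (g ℕ.* block e) ℓ))
        total : (m ℕ.* block e ℕ.+ m ℕ.+ m ℕ.* (ℓ ℕ.∸ 1)) ℕ.+ w e ≡ D
        total = trans (solveℕ 4 (λ m b l v → (m ⊗ b ⊕ m ⊕ m ⊗ l) ⊕ m ⊗ v ⊜ m ⊗ (conℕ 1 ⊕ l) ⊕ m ⊗ (b ⊕ v)) refl m (block e) (ℓ ℕ.∸ 1) (ℓ ℕ.∸ block e))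
          (cong₂ ℕ._+_ (trans (cong (m ℕ.*_) (ℕₚ.m+[n∸m]≡n (ℕ.>-nonZero⁻¹ ℓ))) mℓ≡Q) (trans (cong (m ℕ.*_) (ℕₚ.m+[n∸m]≡n (block≤ℓ e<Q))) mℓ≡Q))
          where
          mℓ≡Q = trans (ℕₚ.*-comm m ℓ) (sym Q≡)

      B-bounded : ∀ {e} → e ℕ.< Q → Bounded D (B e)
      B-bounded {e} e<Q k D≤k = product-bounded e (u e) (w e) k (ℕₚ.≤-trans (degree≤ e<Q) D≤k)

      -- At a point of the curve this is the rescaled Taylor coefficient of `B e` of order `k`, with
      -- the value of the product already collapsed to `κ ^ block e` times a power of `s` below `m`.
      -- As a function of `s` it has degree below `m + 2 k`, although `B e` itself may have degree
      -- near `2 Q`.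
      coefficient : ℕ → ℕ → Carrier → Carrier
      coefficient k e s = (κ ^ block e) * ((s ^ rem e) * rescaled-series e (u e) (w e) s k)

      abstract
        coefficient-poly : ∀ k e → PolyFun (m ℕ.+ (k ℕ.+ k)) (coefficient k e)
        coefficient-poly k e = polyFun-scale (κ ^ block e)
          (polyFun-mono (ℕₚ.≤-trans (ℕₚ.≤-reflexive (ℕₚ.+-suc (rem e) _)) (ℕₚ.+-monoˡ-≤ (k ℕ.+ k) (DivMod.m%n<n e m)))
            (polyFun-^* (rem e) (rescaled-series-poly e (u e) (w e) k)))

      -- The equation that kills the coefficient of `s ^ i` in the order `k` condition. The points
      -- of the curve do not enter, so the number of equations does not grow with the number of
      -- points.
      functional : ℕ → ℕ → Fin Q → Carrier
      functional k i e = proj₁ (coefficient-poly k (toℕ e)) i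

      functionals : ℕ → List (Fin Q → Carrier)
      functionals zero    = []
      functionals (suc k) = applyUpTo (functional k) (m ℕ.+ (k ℕ.+ k)) ++ functionals k

      -- The progression `m + (m + 2) + ... + (m + 2 k)`; this is the origin of the condition
      -- `suc M * (m + M) < Q`.
      length-functionals : ∀ k → length (functionals (suc k)) ≡ suc k ℕ.* (m ℕ.+ k)
      length-functionals k = trans (Listₚ.length-++ (applyUpTo (functional k) (m ℕ.+ (k ℕ.+ k)))) (trans (cong (ℕ._+ length (functionals k)) (Listₚ.length-applyUpTo (functional k) (m ℕ.+ (k ℕ.+ k)))) (step k))
        where
        open NatSolver.+-*-Solver renaming (solve to solveℕ; _:+_ to _⊕_; _:=_ to _⊜_; con to conℕ; _:*_ to _⊗_)
        step : ∀ k → m ℕ.+ (k ℕ.+ k) ℕ.+ length (functionals k) ≡ suc k ℕ.* (m ℕ.+ k)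
        step zero    = solveℕ 1 (λ m → m ⊕ conℕ 0 ⊕ conℕ 0 ⊜ (m ⊕ conℕ 0) ⊕ conℕ 0) refl m
        step (suc k) = trans (cong (m ℕ.+ (suc k ℕ.+ suc k) ℕ.+_) (length-functionals k))
          (solveℕ 2 (λ m k → m ⊕ ((conℕ 1 ⊕ k) ⊕ (conℕ 1 ⊕ k)) ⊕ (conℕ 1 ⊕ k) ⊗ (m ⊕ k) ⊜ (conℕ 2 ⊕ k) ⊗ (m ⊕ (conℕ 1 ⊕ k))) refl m k)

      all-functionals : ∀ (h : Fin Q → Carrier) K → All (λ v → dot h v ≡ 0#) (functionals K) → ∀ k → k ℕ.< K → ∀ i → i ℕ.< m ℕ.+ (k ℕ.+ k) → dot h (functional k i) ≡ 0#
      all-functionals h (suc K) all k k<K i i< with k ℕ.≟ K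
      ... | yes refl = Allₚ.applyUpTo⁻ (functional k) _ (Allₚ.++⁻ˡ (applyUpTo (functional k) _) all) i<
      ... | no k≢K   = all-functionals h K (Allₚ.++⁻ʳ (applyUpTo (functional K) _) all) k (ℕₚ.≤∧≢⇒< (ℕₚ.≤-pred k<K) k≢K) i i<

      ^-Q-multiple : ∀ {x} k → ¬ x ≡ 0# → x ^ (Q ℕ.* k) ≡ 1#
      ^-Q-multiple {x} k x≢0 = trans (^-* x Q k) (trans (cong (_^ k) (^Q≡1 x≢0)) (1^n≡1 k))

      value-on-S : ∀ {s e} → e ℕ.< Q → ¬ X s ≡ 0# → ¬ Y s ≡ 0# → (s ^ m) * (X s ^ (m ℕ.* g)) ≡ κ * (Y s ^ m) →
        value e (u e) (w e) s ≡ (κ ^ block e) * (s ^ rem e)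
      value-on-S {s} {e} e<Q X≢0 Y≢0 relation = begin
        (s ^ e) * ((X s ^ u e) * ((Y s ^ w e) * 1#))
          ≡⟨ cong₂ (λ x y → x * ((X s ^ u e) * y)) s^e (*-identityʳ _) ⟩
        (s ^ rem e) * ((s ^ m) ^ b) * ((X s ^ u e) * (Y s ^ w e))
          ≡⟨ cong (λ x → (s ^ rem e) * ((s ^ m) ^ b) * (x * (Y s ^ w e))) X^u ⟩
        (s ^ rem e) * ((s ^ m) ^ b) * (((X s ^ (m ℕ.* g)) ^ b) * (Y s ^ w e))
          ≡⟨ solve 4 (λ r x y z → (r :* x) :* (y :* z) := r :* ((x :* y) :* z)) refl (s ^ rem e) ((s ^ m) ^ b) ((X s ^ (m ℕ.* g)) ^ b) (Y s ^ w e) ⟩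
        (s ^ rem e) * (((s ^ m) ^ b) * ((X s ^ (m ℕ.* g)) ^ b) * (Y s ^ w e))
          ≡⟨ cong (λ x → (s ^ rem e) * (x * (Y s ^ w e))) (trans (sym (^-*ˡ _ _ b)) (trans (cong (_^ b) relation) (^-*ˡ _ _ b))) ⟩
        (s ^ rem e) * ((κ ^ b) * ((Y s ^ m) ^ b) * (Y s ^ w e))
          ≡⟨ *-congˡ (trans (*-assoc _ _ _) (trans (*-congˡ Y^Q) (*-identityʳ _))) ⟩
        (s ^ rem e) * (κ ^ b) ≡⟨ *-comm _ _ ⟩
        (κ ^ b) * (s ^ rem e) ∎
        where
        b = block e
        s^e : s ^ e ≡ (s ^ rem e) * ((s ^ m) ^ b)
        s^e = trans (cong (s ^_) (trans (DivMod.m≡m%n+[m/n]*n e m) (cong (rem e ℕ.+_) (ℕₚ.*-comm b m)))) (trans (^-+ s (rem e) (m ℕ.* b)) (*-congˡ (^-* s m b)))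
        -- Reducing `g * block e` modulo `ℓ` changes the exponent by a multiple of `m ℓ = Q`, and
        -- `X s ^ Q` is 1.
        X^u : X s ^ u e ≡ (X s ^ (m ℕ.* g)) ^ b
        X^u = sym (begin
          (X s ^ (m ℕ.* g)) ^ b ≡⟨ ^-* (X s) (m ℕ.* g) b ⟨
          X s ^ (m ℕ.* g ℕ.* b) ≡⟨ cong (X s ^_) exponent ⟩
          X s ^ (u e ℕ.+ Q ℕ.* k) ≡⟨ ^-+ (X s) (u e) _ ⟩
          (X s ^ u e) * (X s ^ (Q ℕ.* k)) ≡⟨ *-congˡ (^-Q-multiple k X≢0) ⟩
          (X s ^ u e) * 1# ≡⟨ *-identityʳ _ ⟩
          X s ^ u e ∎)
          where
          k = (g ℕ.* b) DivMod./ ℓ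
          open NatSolver.+-*-Solver renaming (solve to solveℕ; _:+_ to _⊕_; _:=_ to _⊜_; con to conℕ; _:*_ to _⊗_)
          exponent : m ℕ.* g ℕ.* b ≡ u e ℕ.+ Q ℕ.* k
          exponent = trans (ℕₚ.*-assoc m g b) (trans (cong (m ℕ.*_) (DivMod.m≡m%n+[m/n]*n (g ℕ.* b) ℓ))
            (trans (solveℕ 4 (λ m r k l → m ⊗ (r ⊕ k ⊗ l) ⊜ m ⊗ r ⊕ (l ⊗ m) ⊗ k) refl m ((g ℕ.* b) DivMod.% ℓ) k ℓ) (cong (λ Q → u e ℕ.+ Q ℕ.* k) (sym Q≡))))
        Y^Q : ((Y s ^ m) ^ b) * (Y s ^ w e) ≡ 1#
        Y^Q = begin
          ((Y s ^ m) ^ b) * (Y s ^ w e) ≡⟨ cong (_* (Y s ^ w e)) (^-* (Y s) m b) ⟨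
          (Y s ^ (m ℕ.* b)) * (Y s ^ w e) ≡⟨ ^-+ (Y s) (m ℕ.* b) (w e) ⟨
          Y s ^ (m ℕ.* b ℕ.+ w e) ≡⟨ cong (Y s ^_) (trans (sym (ℕₚ.*-distribˡ-+ m b _)) (trans (cong (m ℕ.*_) (ℕₚ.m+[n∸m]≡n (block≤ℓ e<Q))) (trans (ℕₚ.*-comm m ℓ) (sym Q≡)))) ⟩
          Y s ^ Q ≡⟨ ^Q≡1 Y≢0 ⟩
          1# ∎

      module _ (M : ℕ) (h : Fin Q → Carrier)
        (h-functional : ∀ k → k ℕ.< suc M → ∀ i → i ℕ.< m ℕ.+ (k ℕ.+ k) → dot h (functional k i) ≡ 0#) where

        Φ : Poly
        Φ d = dot h (λ e → B (toℕ e) d)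

        Φ-bounded : Bounded D Φ
        Φ-bounded k D≤k = sum-zero {Q} _ (λ e → trans (*-congˡ (B-bounded (Finₚ.toℕ<n e) k D≤k)) (zeroʳ _))

        -- Multiplication by the nonzero `P ^ k` turns the Taylor coefficient of each `B e` into
        -- `coefficient k e s`. The combination of these with weights `h` is a polynomial in `s` all
        -- of whose coefficients are zero by the choice of `h`.
        Φ-vanishes : ∀ {s} → OnCurve m g κ s → VanishesAt D Φ (s , suc M)
        Φ-vanishes {s} (s≢0 , X≢0 , Y≢0 , relation) k k<M = xy≡0⇒y≡0 (^-nonzero k P≢0) (begin
          (P ^ k) * taylor s D Φ k
            ≡⟨ *-congˡ (dot-swap D h (λ e d → B (toℕ e) (toℕ d)) (λ d → translate s (toℕ d) k)) ⟨
          (P ^ k) * dot h (λ e → taylor s D (B (toℕ e)) k)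
            ≡⟨ *-distribˡ-sum {Q} (P ^ k) (λ e → h e * taylor s D (B (toℕ e)) k) ⟩
          sum {Q} (λ e → (P ^ k) * (h e * taylor s D (B (toℕ e)) k))
            ≡⟨ sum-cong-≗ {Q} (λ e → trans (solve 3 (λ p h t → p :* (h :* t) := h :* (t :* p)) refl (P ^ k) (h e) (taylor s D (B (toℕ e)) k)) (*-congˡ (term e))) ⟩
          dot h (λ e → sum {d} (λ i → functional k (toℕ i) e * translate s (toℕ i) 0))
            ≡⟨ dot-swap d h (λ e i → functional k (toℕ i) e) (λ i → translate s (toℕ i) 0) ⟩
          sum {d} (λ i → dot h (functional k (toℕ i)) * translate s (toℕ i) 0)
            ≡⟨ sum-zero {d} _ (λ i → trans (cong (_* translate s (toℕ i) 0) (h-functional k k<M (toℕ i) (Finₚ.toℕ<n i))) (zeroˡ _)) ⟩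
          0# ∎)
          where
          P = s * (X s * Y s)
          P≢0 = *-nonzero s≢0 (*-nonzero X≢0 Y≢0)
          d = m ℕ.+ (k ℕ.+ k)
          term : ∀ e → taylor s D (B (toℕ e)) k * (P ^ k) ≡ sum {d} (λ i → functional k (toℕ i) e * translate s (toℕ i) 0)
          term e = begin
            taylor s D (B e′) k * (P ^ k)
              ≡⟨ cong (_* (P ^ k)) (trans (cong (λ D → taylor s D (B e′) k) (sym (ℕₚ.m∸n+n≡m (degree≤ e<Q)))) (taylor-mono s {p = B e′} (product-bounded e′ (u e′) (w e′)) (D ℕ.∸ (e′ ℕ.+ (u e′ ℕ.+ (w e′ ℕ.+ 1)))) k)) ⟩
            taylor s (e′ ℕ.+ (u e′ ℕ.+ (w e′ ℕ.+ 1))) (B e′) k * (P ^ k)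
              ≡⟨ product-rescaled e′ (u e′) (w e′) s k ⟩
            value e′ (u e′) (w e′) s * rescaled-series e′ (u e′) (w e′) s k
              ≡⟨ trans (*-congʳ (value-on-S e<Q X≢0 Y≢0 relation)) (*-assoc _ _ _) ⟩
            coefficient k e′ s
              ≡⟨ proj₂ (proj₂ (coefficient-poly k e′)) s ⟩
            sum {d} (λ i → functional k (toℕ i) e * translate s (toℕ i) 0) ∎
            where
            e′ = toℕ e
            e<Q = Finₚ.toℕ<n e

        module _ (S : List Carrier) (S-unique : Unique S) (S-points : All (OnCurve m g κ) S) (D≤ : D ℕ.≤ length S ℕ.* suc M) where

          Φ≡0 : ∀ k → Φ k ≡ 0#
          Φ≡0 = roots-bound D (map (_, suc M) S) Φ-bounded (AllPairsₚ.map⁺ S-unique) (Allₚ.map⁺ (All.map Φ-vanishes S-points))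
            (ℕₚ.≤-trans D≤ (ℕₚ.≤-reflexive (sym (multiplicities S))))
            where
            multiplicities : ∀ xs → sum-ℕ (map proj₂ (map (_, suc M) xs)) ≡ length xs ℕ.* suc M
            multiplicities []       = refl
            multiplicities (x ∷ xs) = cong (suc M ℕ.+_) (multiplicities xs)

          -- B e starts with a nonzero multiple of z ^ e, so the B e are independent.
          h≡0 : ∀ e → h e ≡ 0#
          h≡0 e = below (suc (toℕ e)) e ℕₚ.≤-refl
            where
            below : ∀ n e → toℕ e ℕ.< n → h e ≡ 0#
            below (suc n) e (s≤s e≤n) = xy≡0⇒y≡0 (product-leading (toℕ e) (u (toℕ e)) (w (toℕ e)) b₁≢0 b₂≢0) (begin
              B (toℕ e) (toℕ e) * h e ≡⟨ *-comm _ _ ⟩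
              h e * B (toℕ e) (toℕ e) ≡⟨ sum-single (λ e′ → h e′ * B (toℕ e′) (toℕ e)) e others ⟨
              Φ (toℕ e)               ≡⟨ Φ≡0 (toℕ e) ⟩
              0# ∎)
              where
              others : ∀ e′ → ¬ e′ ≡ e → h e′ * B (toℕ e′) (toℕ e) ≡ 0#
              others e′ e′≢e with ℕₚ.<-cmp (toℕ e′) (toℕ e)
              ... | tri< e′<e _ _ = trans (cong (_* B (toℕ e′) (toℕ e)) (below n e′ (ℕₚ.<-≤-trans e′<e e≤n))) (zeroˡ _)
              ... | tri≈ _ e′≡e _ = contradiction (Finₚ.toℕ-injective e′≡e) e′≢e
              ... | tri> _ _ e<e′ = trans (*-congˡ (product-low (toℕ e′) (u (toℕ e′)) (w (toℕ e′)) e<e′)) (zeroʳ _)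

      -- Fewer conditions than the `Q` unknowns leave a nonzero `h`. If the zeros exhausted the
      -- degree bound `2 Q`, then `Φ` would be zero and independence of the `B e` would force `h` to
      -- be zero.
      stepanov : (S : List Carrier) → Unique S → All (OnCurve m g κ) S →
        (M : ℕ) → suc M ℕ.* (m ℕ.+ M) ℕ.< Q → length S ℕ.* suc M ℕ.< Q ℕ.+ Q
      stepanov S S-unique S-points M M< = conclude (kernel (lookup (functionals (suc M))) (subst (ℕ._< Q) (sym (length-functionals M)) M<))
        where
        conclude : (∃[ h ] (¬ (∀ e → h e ≡ 0#) × ∀ c → dot h (lookup (functionals (suc M)) c) ≡ 0#)) → length S ℕ.* suc M ℕ.< Q ℕ.+ Q
        conclude (h , h≢0 , h-kernel) = ℕₚ.≰⇒> λ D≤ → h≢0 (h≡0 M h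
          (all-functionals h (suc M) (All.tabulate (λ v∈ → trans (cong (dot h) (lookup-index v∈)) (h-kernel (index v∈)))))
          S S-unique S-points D≤)

-- Counting with sums of natural numbers.

module NatCounting where

  open import Data.Nat
  open import Data.Nat.Properties

  open import Algebra.Properties.Semiring.Sum +-*-semiring public
    using (sum; sum-cong-≗; ∑-comm; *-distribˡ-sum; *-distribʳ-sum)

  sum-mono : ∀ {n} {s t : Fin n → ℕ} → (∀ i → s i ≤ t i) → sum s ≤ sum t
  sum-mono {zero}  le = z≤n
  sum-mono {suc n} le = +-mono-≤ (le Fin.zero) (sum-mono (le ∘ Fin.suc))

  sum-const : ∀ n c → sum {n} (λ _ → c) ≡ n * c
  sum-const zero    c = refl
  sum-const (suc n) c = cong (c +_) (sum-const n c)

  sum-suc : ∀ n (t : ℕ → ℕ) → sum {n} (λ i → t (suc (toℕ i))) + t 0 ≡ sum {n} (t ∘ toℕ) + t n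
  sum-suc zero    t = refl
  sum-suc (suc n) t = begin
    t 1 + s + t 0     ≡⟨ +-comm _ (t 0) ⟩
    t 0 + (t 1 + s)   ≡⟨ cong (t 0 +_) (trans (+-comm (t 1) s) (sum-suc n (t ∘ suc))) ⟩
    t 0 + (sum {n} (λ i → t (suc (toℕ i))) + t (suc n)) ≡⟨ +-assoc (t 0) _ _ ⟨
    t 0 + sum {n} (λ i → t (suc (toℕ i))) + t (suc n) ∎
    where
    open ≡-Reasoning
    s = sum {n} (λ i → t (suc (suc (toℕ i))))

  -- Moving the window by one place loses `t d` and gains the equal term `t (n + d)`.
  sum-periodic : ∀ n (t : ℕ → ℕ) → (∀ e → t (n + e) ≡ t e) → ∀ d → sum {n} (λ i → t (toℕ i + d)) ≡ sum {n} (t ∘ toℕ)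
  sum-periodic n t periodic zero    = sum-cong-≗ {n} (λ i → cong t (+-identityʳ (toℕ i)))
  sum-periodic n t periodic (suc d) = trans
    (+-cancelʳ-≡ (t (0 + d)) _ _ (trans (cong (_+ t d) (sum-cong-≗ {n} (λ i → cong t (+-suc (toℕ i) d))))
      (trans (sum-suc n (λ e → t (e + d))) (cong (sum {n} (λ i → t (toℕ i + d)) +_) (periodic d)))))
    (sum-periodic n t periodic d)

  2ab≤a²+b² : ∀ a b → 2 * (a * b) ≤ a * a + b * b
  2ab≤a²+b² zero    b       = z≤n
  2ab≤a²+b² (suc a) zero    rewrite *-zeroʳ a = z≤n
  2ab≤a²+b² (suc a) (suc b) = begin
    2 * (suc a * suc b)             ≡⟨ solve 2 (λ a b → con 2 :* ((con 1 :+ a) :* (con 1 :+ b)) := con 2 :* (a :* b) :+ con 2 :* (con 1 :+ a :+ b)) refl a b ⟩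
    2 * (a * b) + 2 * (1 + a + b)   ≤⟨ +-monoˡ-≤ _ (2ab≤a²+b² a b) ⟩
    a * a + b * b + 2 * (1 + a + b) ≡⟨ solve 2 (λ a b → a :* a :+ b :* b :+ con 2 :* (con 1 :+ a :+ b) := (con 1 :+ a) :* (con 1 :+ a) :+ (con 1 :+ b) :* (con 1 :+ b)) refl a b ⟩
    suc a * suc a + suc b * suc b   ∎
    where
    open ≤-Reasoning
    open NatSolver.+-*-Solver

  -- This bounds the cross terms between a new entry `a` and the earlier ones in the induction for
  -- `cauchy-schwarz`, with no subtraction.
  2a∑≤∑²+na² : ∀ {n} a (s : Fin n → ℕ) → 2 * (a * sum s) ≤ sum (λ i → s i * s i) + n * (a * a)
  2a∑≤∑²+na² {zero}  a s rewrite *-zeroʳ a = z≤n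
  2a∑≤∑²+na² {suc n} a s = begin
    2 * (a * (b + S))                   ≡⟨ solve 3 (λ a b S → con 2 :* (a :* (b :+ S)) := con 2 :* (a :* b) :+ con 2 :* (a :* S)) refl a b S ⟩
    2 * (a * b) + 2 * (a * S)           ≤⟨ +-mono-≤ (2ab≤a²+b² a b) (2a∑≤∑²+na² a (s ∘ Fin.suc)) ⟩
    (a * a + b * b) + (T + n * (a * a)) ≡⟨ solve 4 (λ A B T n → (A :+ B) :+ (T :+ n :* A) := (B :+ T) :+ (A :+ n :* A)) refl (a * a) (b * b) T n ⟩
    (b * b + T) + suc n * (a * a)       ∎
    where
    open ≤-Reasoning
    open NatSolver.+-*-Solver
    b = s Fin.zero
    S = sum (s ∘ Fin.suc)
    T = sum (λ i → s (Fin.suc i) * s (Fin.suc i))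

  cauchy-schwarz : ∀ {n} (s : Fin n → ℕ) → sum s * sum s ≤ n * sum (λ i → s i * s i)
  cauchy-schwarz {zero}  s = z≤n
  cauchy-schwarz {suc n} s = begin
    (a + S) * (a + S)                         ≡⟨ solve 2 (λ a S → (a :+ S) :* (a :+ S) := a :* a :+ con 2 :* (a :* S) :+ S :* S) refl a S ⟩
    a * a + 2 * (a * S) + S * S               ≤⟨ +-mono-≤ (+-monoʳ-≤ (a * a) (2a∑≤∑²+na² a (s ∘ Fin.suc))) (cauchy-schwarz (s ∘ Fin.suc)) ⟩
    a * a + (T + n * (a * a)) + n * T         ≡⟨ solve 3 (λ A T n → A :+ (T :+ n :* A) :+ n :* T := (A :+ T) :+ n :* (A :+ T)) refl (a * a) T n ⟩
    suc n * (a * a + T)                       ∎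
    where
    open ≤-Reasoning
    open NatSolver.+-*-Solver
    a = s Fin.zero
    S = sum (s ∘ Fin.suc)
    T = sum (λ i → s (Fin.suc i) * s (Fin.suc i))

  -- Intended for one row of the matrix of pair counts: the diagonal entry is the full count `K`,
  -- every other entry is small.
  sum-one-large : ∀ {n} (t : Fin (suc n) → ℕ) i K c → t i ≤ K → (∀ j → ¬ j ≡ i → t j ≤ c) → sum t ≤ K + n * c
  sum-one-large {n} t Fin.zero K c ti≤ tj≤ =
    +-mono-≤ ti≤ (≤-trans (sum-mono (λ j → tj≤ (Fin.suc j) λ ())) (≤-reflexive (sum-const n c)))
  sum-one-large {suc n} t (Fin.suc i) K c ti≤ tj≤ = begin
    t Fin.zero + sum (t ∘ Fin.suc) ≤⟨ +-mono-≤ (tj≤ Fin.zero λ ()) (sum-one-large (t ∘ Fin.suc) i K c ti≤ (λ j j≢i → tj≤ (Fin.suc j) (j≢i ∘ Finₚ.suc-injective))) ⟩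
    c + (K + n * c)                ≡⟨ solve 3 (λ c K r → c :+ (K :+ r) := K :+ (c :+ r)) refl c K (n * c) ⟩
    K + suc n * c                  ∎
    where
    open ≤-Reasoning
    open NatSolver.+-*-Solver

  indicator : ∀ {p} {P : Set p} → Dec P → ℕ
  indicator (yes _) = 1
  indicator (no _)  = 0

  indicator-× : ∀ {p} {P P′ : Set p} (d : Dec P) (d′ : Dec P′) → indicator d * indicator d′ ≡ indicator (d ×-dec d′)
  indicator-× (yes _) (yes _) = refl
  indicator-× (yes _) (no _)  = refl
  indicator-× (no _)  _       = refl

  sum-indicator : ∀ {a p} {A : Set a} {P : Pred A p} (P? : Decidable P) (f : ℕ → A) n →
    sum {n} (λ i → indicator (P? (f (toℕ i)))) ≡ length (filter P? (applyUpTo f n))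
  sum-indicator P? f zero    = refl
  sum-indicator P? f (suc n) with P? (f 0)
  ... | yes _ = cong suc (sum-indicator P? (f ∘ suc) n)
  ... | no _  = sum-indicator P? (f ∘ suc) n

  -- Counts the pairs of points with exponents congruent modulo ℓ, once from below by
  -- the Cauchy-Schwarz inequality and once from above by their difference.
  pair-count : ∀ {Q m ℓ c} (χ : ℕ → ℕ) → (∀ e → χ (Q + e) ≡ χ e) → (∀ e → χ e * χ e ≡ χ e) →
    (∀ k k′ → k < suc m → k′ < suc m → ¬ k ≡ k′ → sum {Q} (λ i → χ (toℕ i + k * ℓ) * χ (toℕ i + k′ * ℓ)) ≤ c) →
    let K = sum {Q} (χ ∘ toℕ) in suc m * (K * K) ≤ Q * (K + m * c)
  pair-count {Q} {m} {ℓ} {c} χ periodic idem pairs = *-cancelˡ-≤ (suc m) (begin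
    suc m * (suc m * (K * K))       ≡⟨ solve 2 (λ m K → m :* (m :* (K :* K)) := (m :* K) :* (m :* K)) refl (suc m) K ⟩
    (suc m * K) * (suc m * K)       ≡⟨ cong₂ _*_ total total ⟨
    sum s * sum s                   ≤⟨ cauchy-schwarz s ⟩
    Q * sum {Q} (λ i → s i * s i)       ≤⟨ *-monoʳ-≤ Q squares ⟩
    Q * (suc m * (K + m * c))       ≡⟨ solve 3 (λ Q m x → Q :* (m :* x) := m :* (Q :* x)) refl Q (suc m) (K + m * c) ⟩
    suc m * (Q * (K + m * c))       ∎)
    where
    open ≤-Reasoning
    open NatSolver.+-*-Solver
    K = sum {Q} (χ ∘ toℕ)
    t : Fin Q → Fin (suc m) → ℕ
    t i k = χ (toℕ i + toℕ k * ℓ)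
    s : Fin Q → ℕ
    s i = sum {suc m} (t i)
    column : ∀ k → sum {Q} (λ i → t i k) ≡ K
    column k = sum-periodic Q χ periodic (toℕ k * ℓ)
    total : sum s ≡ suc m * K
    total = trans (∑-comm t) (trans (sum-cong-≗ {suc m} column) (sum-const (suc m) K))
    row : ∀ k → sum {suc m} (λ k′ → sum {Q} (λ i → t i k * t i k′)) ≤ K + m * c
    row k = sum-one-large (λ k′ → sum {Q} (λ i → t i k * t i k′)) k K c
      (≤-reflexive (trans (sum-cong-≗ {Q} (λ i → idem (toℕ i + toℕ k * ℓ))) (column k)))
      (λ k′ k′≢k → pairs (toℕ k) (toℕ k′) (Finₚ.toℕ<n k) (Finₚ.toℕ<n k′) (λ eq → k′≢k (sym (Finₚ.toℕ-injective eq))))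
    squares : sum {Q} (λ i → s i * s i) ≤ suc m * (K + m * c)
    squares = begin
      sum {Q} (λ i → s i * s i)
        ≡⟨ sum-cong-≗ {Q} (λ i → trans (*-distribʳ-sum {suc m} (s i) (t i)) (sum-cong-≗ {suc m} (λ k → *-distribˡ-sum {suc m} (t i k) (t i)))) ⟩
      sum {Q} (λ i → sum {suc m} (λ k → sum {suc m} (λ k′ → t i k * t i k′)))
        ≡⟨ ∑-comm {Q} {suc m} (λ i k → sum {suc m} (λ k′ → t i k * t i k′)) ⟩
      sum {suc m} (λ k → sum {Q} (λ i → sum {suc m} (λ k′ → t i k * t i k′)))
        ≡⟨ sum-cong-≗ {suc m} (λ k → ∑-comm {Q} {suc m} (λ i k′ → t i k * t i k′)) ⟩
      sum {suc m} (λ k → sum {suc m} (λ k′ → sum {Q} (λ i → t i k * t i k′)))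
        ≤⟨ sum-mono {suc m} row ⟩
      sum {suc m} (λ k → K + m * c) ≡⟨ sum-const (suc m) (K + m * c) ⟩
      suc m * (K + m * c) ∎

-- The numerical comparison of the two estimates.

module Arithmetic where

  open import Data.Nat
  open import Data.Nat.Properties
  open import Data.Nat.DivMod using (_/_; _%_; m≡m%n+[m/n]*n; m%n<n; m/n*n≤m)
  open NatSolver.+-*-Solver

  -- To leading order, `Q ≤ K² / 9` turns the term `2 m Q` of the pair estimate into at most 2/9 of
  -- `suc m * K²`. The remaining 7/9 is bounded by `Q K`, and dividing by `K` gives the claim.
  7mK≤9Q : ∀ K Q m → 1 ≤ K → 9 * Q + 9 ≤ K * K + 2 * K → suc m * (K * K) ≤ Q * (K + m * 2) → 7 * (suc m * K) ≤ 9 * Q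
  7mK≤9Q K Q m 1≤K large pairs = ≮⇒≥ λ 9Q<7mK → contradict (proj₁ (diff 9Q<7mK)) (proj₂ (diff 9Q<7mK))
    where
    open ≤-Reasoning
    diff : 9 * Q < 7 * (suc m * K) → ∃[ y ] 7 * (suc m * K) ≡ suc (9 * Q) + y
    diff lt = 7 * (suc m * K) ∸ suc (9 * Q) , sym (m+[n∸m]≡n lt)
    n = suc m
    -- 63 · pairs + 14 (m + 1) · large, with the common terms cancelled.
    combined : 49 * (n * (K * K)) + 126 * Q + 126 * n ≤ 63 * (Q * K) + 28 * (n * K)
    combined = +-cancelʳ-≤ (14 * (n * (K * K)) + 126 * (Q * n)) _ _ (begin
      49 * (n * (K * K)) + 126 * Q + 126 * n + (14 * (n * (K * K)) + 126 * (Q * n))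
        ≡⟨ solve 3 (λ n K Q → con 49 :* (n :* (K :* K)) :+ con 126 :* Q :+ con 126 :* n :+ (con 14 :* (n :* (K :* K)) :+ con 126 :* (Q :* n))
             := con 63 :* (n :* (K :* K)) :+ con 126 :* Q :+ con 14 :* n :* (con 9 :* Q :+ con 9)) refl n K Q ⟩
      63 * (n * (K * K)) + 126 * Q + 14 * n * (9 * Q + 9)
        ≤⟨ +-mono-≤ (+-monoˡ-≤ (126 * Q) (*-monoʳ-≤ 63 pairs)) (*-monoʳ-≤ (14 * n) large) ⟩
      63 * (Q * (K + m * 2)) + 126 * Q + 14 * n * (K * K + 2 * K)
        ≡⟨ solve 3 (λ m K Q → con 63 :* (Q :* (K :+ m :* con 2)) :+ con 126 :* Q :+ con 14 :* (con 1 :+ m) :* (K :* K :+ con 2 :* K)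
             := con 63 :* (Q :* K) :+ con 28 :* ((con 1 :+ m) :* K) :+ (con 14 :* ((con 1 :+ m) :* (K :* K)) :+ con 126 :* (Q :* (con 1 :+ m)))) refl m K Q ⟩
      63 * (Q * K) + 28 * (n * K) + (14 * (n * (K * K)) + 126 * (Q * n)) ∎)
    -- Substituting `7 n K = 9 Q + 1 + y` into `combined` cancels `63 Q K` and leaves `7 K + 7 K y +
    -- 126 Q + 126 n ≤ 36 Q + 4 + 4 y`, impossible for `K ≥ 1`.
    contradict : ∀ y → ¬ 7 * (n * K) ≡ suc (9 * Q) + y
    contradict y eq = <⇒≱ (begin-strict
      36 * Q + 4 + 4 * y + 63 * (Q * K)
        <⟨ +-monoˡ-< (63 * (Q * K)) (+-mono-<-≤ (+-mono-≤-< (*-monoˡ-≤ Q (m≤m+n 36 90)) (+-monoˡ-≤ 3 (*-monoʳ-≤ 2 1≤K))) (*-monoʳ-≤ 4 (≤-trans (≤-reflexive (sym (*-identityˡ y))) (*-monoˡ-≤ y 1≤K)))) ⟩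
      126 * Q + (2 * K + 3) + 4 * (K * y) + 63 * (Q * K)
        ≤⟨ +-monoˡ-≤ (63 * (Q * K)) (+-mono-≤ (+-monoʳ-≤ (126 * Q) (+-monoʳ-≤ (2 * K) (≤-trans (*-monoʳ-≤ 3 1≤K) (*-monoˡ-≤ K (m≤m+n 3 2))))) (*-monoˡ-≤ (K * y) (m≤m+n 4 3))) ⟩
      126 * Q + (2 * K + 5 * K) + 7 * (K * y) + 63 * (Q * K)
        ≤⟨ m≤m+n _ (126 * n) ⟩
      126 * Q + (2 * K + 5 * K) + 7 * (K * y) + 63 * (Q * K) + 126 * n
        ≡⟨ solve 4 (λ Q K y n → con 126 :* Q :+ (con 2 :* K :+ con 5 :* K) :+ con 7 :* (K :* y) :+ con 63 :* (Q :* K) :+ con 126 :* n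
             := con 7 :* K :* (con 1 :+ con 9 :* Q :+ y) :+ con 126 :* Q :+ con 126 :* n) refl Q K y n ⟩
      7 * K * (suc (9 * Q) + y) + 126 * Q + 126 * n ∎)
      (begin
      7 * K * (suc (9 * Q) + y) + 126 * Q + 126 * n
        ≡⟨ cong (λ x → 7 * K * x + 126 * Q + 126 * n) eq ⟨
      7 * K * (7 * (n * K)) + 126 * Q + 126 * n
        ≡⟨ solve 3 (λ n K Q → con 7 :* K :* (con 7 :* (n :* K)) :+ con 126 :* Q :+ con 126 :* n := con 49 :* (n :* (K :* K)) :+ con 126 :* Q :+ con 126 :* n) refl n K Q ⟩
      49 * (n * (K * K)) + 126 * Q + 126 * n
        ≤⟨ combined ⟩
      63 * (Q * K) + 28 * (n * K)
        ≡⟨ cong (63 * (Q * K) +_) (trans (solve 1 (λ x → con 28 :* x := con 4 :* (con 7 :* x)) refl (n * K)) (cong (4 *_) eq)) ⟩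
      63 * (Q * K) + 4 * (suc (9 * Q) + y)
        ≡⟨ solve 3 (λ Q K y → con 63 :* (Q :* K) :+ con 4 :* (con 1 :+ con 9 :* Q :+ y) := con 36 :* Q :+ con 4 :+ con 4 :* y :+ con 63 :* (Q :* K)) refl Q K y ⟩
      36 * Q + 4 + 4 * y + 63 * (Q * K) ∎)

  -- The condition `(M + 1) (m + M) < Q` multiplied by `K²`, with `K M` replaced by its upper bound
  -- `2 Q - 1`. This removes the quotient `M` from the inequality.
  Key : ℕ → ℕ → ℕ → Set
  Key K Q m = (pred (2 * Q) + K) * (pred (2 * Q) + K * m) < Q * (K * K)

  -- The quadratic estimate behind key only holds from K = 17 on.
  key-small : ∀ {K} → K < 17 → ∀ {Q} → Q < 33 → ∀ {m} → m < 3 → K ≤ Q → 9 * Q + 9 ≤ K * K + 2 * K → 7 * (m * K) ≤ 9 * Q → Key K Q m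
  key-small = from-yes (allUpTo? (λ K → allUpTo? (λ Q → allUpTo? (λ m →
    (K ≤? Q) →-dec ((9 * Q + 9 ≤? K * K + 2 * K) →-dec ((7 * (m * K) ≤? 9 * Q) →-dec
      ((pred (2 * Q) + K) * (pred (2 * Q) + K * m) <? Q * (K * K))))) 3) 33) 17)

  -- Inserting `7 m K ≤ 9 Q` reduces the claim to `23 (2 Q + K) ≤ 7 K²`, where 23 is 14 + 9.
  -- Bounding `Q` through `large` turns this into `17 K² - 299 K + 414 ≥ 0`, whose larger root lies
  -- between 16 and 17. Below 17 the hypotheses force `Q < 33` and `m < 3`, so finitely many cases
  -- remain.
  key : ∀ K Q m → 1 ≤ K → K ≤ Q → 9 * Q + 9 ≤ K * K + 2 * K → 7 * (m * K) ≤ 9 * Q → Key K Q m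
  key K Q m 1≤K K≤Q large 7mK≤ with K <? 17
  ... | yes K<17 = key-small K<17 Q<33 m<3 K≤Q large 7mK≤
    where
    open ≤-Reasoning
    K≤16 : K ≤ 16
    K≤16 = ≤-pred K<17
    Q<33 : Q < 33
    Q<33 = *-cancelˡ-< 9 Q 33 (begin-strict
      9 * Q             <⟨ m<m+n (9 * Q) (s≤s z≤n) ⟩
      9 * Q + 9         ≤⟨ large ⟩
      K * K + 2 * K     ≤⟨ +-mono-≤ (*-mono-≤ K≤16 K≤16) (*-monoʳ-≤ 2 K≤16) ⟩
      288               ≤⟨ m≤m+n 288 9 ⟩
      297               ∎)
    m<3 : m < 3
    m<3 = *-cancelʳ-< (7 * K) m 3 (begin-strict
      m * (7 * K)       ≡⟨ solve 2 (λ m K → m :* (con 7 :* K) := con 7 :* (m :* K)) refl m K ⟩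
      7 * (m * K)       ≤⟨ 7mK≤ ⟩
      9 * Q             <⟨ m<m+n (9 * Q) (s≤s z≤n) ⟩
      9 * Q + 9         ≤⟨ large ⟩
      K * K + 2 * K     ≤⟨ +-monoˡ-≤ (2 * K) (*-monoˡ-≤ K K≤16) ⟩
      16 * K + 2 * K    ≡⟨ solve 1 (λ K → con 16 :* K :+ con 2 :* K := con 18 :* K) refl K ⟩
      18 * K            ≤⟨ *-monoˡ-≤ K (m≤m+n 18 3) ⟩
      21 * K            ≡⟨ solve 1 (λ K → con 21 :* K := con 3 :* (con 7 :* K)) refl K ⟩
      3 * (7 * K)       ∎)
  ... | no K≮17 = *-cancelˡ-< 7 _ _ (begin-strict
    7 * ((N + K) * (N + K * m))
      ≡⟨ solve 3 (λ N K m → con 7 :* ((N :+ K) :* (N :+ K :* m)) := (N :+ K) :* (con 7 :* N :+ con 7 :* (m :* K))) refl N K m ⟩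
    (N + K) * (7 * N + 7 * (m * K))
      ≤⟨ *-monoʳ-≤ (N + K) (+-mono-≤ (*-monoʳ-≤ 7 (pred[n]≤n {2 * Q})) 7mK≤) ⟩
    (N + K) * (7 * (2 * Q) + 9 * Q)
      ≡⟨ solve 2 (λ x Q → x :* (con 7 :* (con 2 :* Q) :+ con 9 :* Q) := con 23 :* x :* Q) refl (N + K) Q ⟩
    23 * (N + K) * Q
      <⟨ *-monoˡ-< Q (*-monoʳ-< 23 (+-monoˡ-< K N<2Q)) ⟩
    23 * (2 * Q + K) * Q
      ≤⟨ *-monoˡ-≤ Q quadratic ⟩
    7 * (K * K) * Q
      ≡⟨ solve 2 (λ K Q → con 7 :* (K :* K) :* Q := con 7 :* (Q :* (K :* K))) refl K Q ⟩
    7 * (Q * (K * K)) ∎)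
    where
    open ≤-Reasoning
    N = pred (2 * Q)
    instance
      Q-nonZero : NonZero Q
      Q-nonZero = >-nonZero (≤-trans 1≤K K≤Q)
    N<2Q : N < 2 * Q
    N<2Q = ≤-reflexive (suc-pred (2 * Q) {{m*n≢0 2 Q}})
    k = K ∸ 17
    K≡ : K ≡ 17 + k
    K≡ = sym (m+[n∸m]≡n (≮⇒≥ K≮17))
    quadratic : 23 * (2 * Q + K) ≤ 7 * (K * K)
    quadratic = *-cancelˡ-≤ 9 (+-cancelʳ-≤ 414 _ _ (begin
      9 * (23 * (2 * Q + K)) + 414
        ≡⟨ solve 2 (λ Q K → con 9 :* (con 23 :* (con 2 :* Q :+ K)) :+ con 414 := con 46 :* (con 9 :* Q :+ con 9) :+ con 207 :* K) refl Q K ⟩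
      46 * (9 * Q + 9) + 207 * K
        ≤⟨ +-monoˡ-≤ (207 * K) (*-monoʳ-≤ 46 large) ⟩
      46 * (K * K + 2 * K) + 207 * K
        ≡⟨ cong (λ K → 46 * (K * K + 2 * K) + 207 * K) K≡ ⟩
      46 * ((17 + k) * (17 + k) + 2 * (17 + k)) + 207 * (17 + k)
        -- The added polynomial is `17 K² - 299 K + 414` at `K = 17 + k`; its nonnegative
        -- coefficients show the sign.
        ≤⟨ m≤m+n _ (17 * (k * k) + 279 * k + 244) ⟩
      46 * ((17 + k) * (17 + k) + 2 * (17 + k)) + 207 * (17 + k) + (17 * (k * k) + 279 * k + 244)
        ≡⟨ solve 1 (λ k → con 46 :* ((con 17 :+ k) :* (con 17 :+ k) :+ con 2 :* (con 17 :+ k)) :+ con 207 :* (con 17 :+ k) :+ (con 17 :* (k :* k) :+ con 279 :* k :+ con 244)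
             := con 9 :* (con 7 :* ((con 17 :+ k) :* (con 17 :+ k))) :+ con 414) refl k ⟩
      9 * (7 * ((17 + k) * (17 + k))) + 414
        ≡⟨ cong (λ K → 9 * (7 * (K * K)) + 414) K≡ ⟨
      9 * (7 * (K * K)) + 414 ∎))

  -- M + 1 is the least multiplicity for which K zeros of that multiplicity exceed the degree 2Q - 1.
  multiplicity : ∀ K Q m → 1 ≤ K → K ≤ Q → 9 * Q + 9 ≤ K * K + 2 * K → suc m * (K * K) ≤ Q * (K + m * 2) →
    ∃[ M ] (suc M * (suc m + M) < Q × Q + Q ≤ K * suc M)
  multiplicity K@(suc _) Q@(suc _) m 1≤K K≤Q large pairs = M , ≰⇒> conditions , degree
    where
    open ≤-Reasoning
    N = pred (2 * Q)
    M = N / K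
    KM≤N : K * M ≤ N
    KM≤N = ≤-trans (≤-reflexive (*-comm K M)) (m/n*n≤m N K)
    degree : Q + Q ≤ K * suc M
    degree = begin
      Q + Q ≡⟨ cong (Q +_) (+-identityʳ Q) ⟨
      suc N ≤⟨ s≤s (≤-reflexive (m≡m%n+[m/n]*n N K)) ⟩
      suc (N % K) + M * K ≤⟨ +-monoˡ-≤ (M * K) (m%n<n N K) ⟩
      suc M * K ≡⟨ *-comm (suc M) K ⟩
      K * suc M ∎
    conditions : ¬ Q ≤ suc M * (suc m + M)
    conditions Q≤ = <⇒≱ (key K Q (suc m) 1≤K K≤Q large (7mK≤9Q K Q m 1≤K large pairs)) (begin
      Q * (K * K) ≤⟨ *-monoˡ-≤ (K * K) Q≤ ⟩
      suc M * (suc m + M) * (K * K)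
        ≡⟨ solve 3 (λ M m K → (con 1 :+ M) :* (m :+ M) :* (K :* K) := (K :* M :+ K) :* (K :* M :+ K :* m)) refl M (suc m) K ⟩
      (K * M + K) * (K * M + K * suc m) ≤⟨ *-mono-≤ (+-monoˡ-≤ K KM≤N) (+-monoˡ-≤ (K * suc m) KM≤N) ⟩
      (N + K) * (N + K * suc m) ∎)

-- Powers of a primitive element.

module PrimitiveElement (F : FiniteField) (ξ : FiniteField.Carrier F) (ξ-primitive : IsPrimitive F ξ) where

  open FiniteField F
  open FieldProperties F
  open Stepanov F
  open ≡-Reasoning

  Q : ℕ
  Q = q ℕ.∸ 1

  q≡1+Q : q ≡ suc Q
  q≡1+Q = sym (ℕₚ.m+[n∸m]≡n (ℕₚ.<⇒≤ 1<q))

  ξ≢0 : ¬ ξ ≡ 0#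
  ξ≢0 = proj₁ ξ-primitive

  ξ^≢0 : ∀ e → ¬ ξ ^ e ≡ 0#
  ξ^≢0 e = ^-nonzero e ξ≢0

  ξ^-≡⇒∸ : ∀ i j → i ℕ.< j → ξ ^ i ≡ ξ ^ j → ξ ^ (j ℕ.∸ i) ≡ 1#
  ξ^-≡⇒∸ i j i<j eq = sym (*-cancelˡ-nonzero (ξ ^ i) (ξ^≢0 i) (begin
    (ξ ^ i) * 1#              ≡⟨ *-identityʳ _ ⟩
    ξ ^ i                     ≡⟨ eq ⟩
    ξ ^ j                     ≡⟨ cong (ξ ^_) (ℕₚ.m+[n∸m]≡n (ℕₚ.<⇒≤ i<j)) ⟨
    ξ ^ (i ℕ.+ (j ℕ.∸ i))     ≡⟨ ^-+ ξ i (j ℕ.∸ i) ⟩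
    (ξ ^ i) * (ξ ^ (j ℕ.∸ i)) ∎))

  ξ^-distinct : ∀ {i j} → i ℕ.< j → j ℕ.< Q → ¬ ξ ^ i ≡ ξ ^ j
  ξ^-distinct {i} {j} i<j j<Q eq =
    proj₂ ξ-primitive (j ℕ.∸ i) (ℕₚ.m<n⇒0<n∸m i<j) (ℕₚ.≤-<-trans (ℕₚ.m∸n≤m j i) j<Q) (ξ^-≡⇒∸ i j i<j eq)

  -- Primitivity only excludes smaller exponents. Among zero and the powers with exponents `0` to
  -- `Q` two entries coincide; the resulting exponent difference is positive, at most `Q`, and
  -- cannot be below `Q`.
  ξ^Q≡1 : ξ ^ Q ≡ 1#
  ξ^Q≡1 with Finₚ.pigeonhole (ℕₚ.n<1+n q) items
    where
    items : Fin (suc q) → Fin q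
    items Fin.zero    = from 0#
    items (Fin.suc i) = from (ξ ^ toℕ i)
  ... | Fin.zero  , Fin.suc j , _   , eq = contradiction (sym (from-injective eq)) (ξ^≢0 (toℕ j))
  ... | Fin.suc i , Fin.suc j , s≤s i<j , eq with d ← ξ^-≡⇒∸ (toℕ i) (toℕ j) i<j (from-injective eq) | toℕ j ℕ.∸ toℕ i ℕ.<? Q
  ... | yes d<Q = contradiction d (proj₂ ξ-primitive (toℕ j ℕ.∸ toℕ i) (ℕₚ.m<n⇒0<n∸m i<j) d<Q)
  ... | no d≮Q  = subst (λ n → ξ ^ n ≡ 1#) (ℕₚ.≤-antisym (ℕₚ.≤-trans (ℕₚ.m∸n≤m (toℕ j) (toℕ i)) (ℕₚ.≤-pred (ℕₚ.≤-trans (Finₚ.toℕ<n j) (ℕₚ.≤-reflexive q≡1+Q)))) (ℕₚ.≮⇒≥ d≮Q)) d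

  -- Zero, `x` and the `Q` distinct powers are one entry more than the field has elements. The only
  -- collision possible is between `x` and a power.
  log : ∀ {x} → ¬ x ≡ 0# → ∃[ e ] (e ℕ.< Q × x ≡ ξ ^ e)
  log {x} x≢0 with Finₚ.pigeonhole (ℕₚ.≤-reflexive (cong suc q≡1+Q)) items
    where
    items : Fin (suc (suc Q)) → Fin q
    items Fin.zero              = from 0#
    items (Fin.suc Fin.zero)    = from x
    items (Fin.suc (Fin.suc i)) = from (ξ ^ toℕ i)
  ... | Fin.zero , Fin.suc Fin.zero , _ , eq = contradiction (sym (from-injective eq)) x≢0
  ... | Fin.zero , Fin.suc (Fin.suc j) , _ , eq = contradiction (sym (from-injective eq)) (ξ^≢0 (toℕ j))
  ... | Fin.suc Fin.zero , Fin.suc (Fin.suc j) , _ , eq = toℕ j , Finₚ.toℕ<n j , from-injective eq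
  ... | Fin.suc (Fin.suc i) , Fin.suc (Fin.suc j) , s≤s (s≤s i<j) , eq = contradiction (from-injective eq) (ξ^-distinct i<j (Finₚ.toℕ<n j))
  ... | Fin.suc Fin.zero , Fin.suc Fin.zero , s≤s () , eq

  ξ^-Q* : ∀ k → ξ ^ (Q ℕ.* k) ≡ 1#
  ξ^-Q* k = trans (^-* ξ Q k) (trans (cong (_^ k) ξ^Q≡1) (1^n≡1 k))

  ξ^-periodic : ∀ e → ξ ^ (Q ℕ.+ e) ≡ ξ ^ e
  ξ^-periodic e = trans (^-+ ξ Q e) (trans (cong (_* (ξ ^ e)) ξ^Q≡1) (*-identityˡ _))

  ξ^-% : ∀ .{{_ : ℕ.NonZero Q}} e → ξ ^ e ≡ ξ ^ (e DivMod.% Q)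
  ξ^-% e = begin
    ξ ^ e ≡⟨ cong (ξ ^_) (trans (DivMod.m≡m%n+[m/n]*n e Q) (cong (e DivMod.% Q ℕ.+_) (ℕₚ.*-comm (e DivMod./ Q) Q))) ⟩
    ξ ^ (e DivMod.% Q ℕ.+ Q ℕ.* (e DivMod./ Q)) ≡⟨ ^-+ ξ (e DivMod.% Q) _ ⟩
    (ξ ^ (e DivMod.% Q)) * (ξ ^ (Q ℕ.* (e DivMod./ Q))) ≡⟨ *-congˡ (ξ^-Q* (e DivMod./ Q)) ⟩
    (ξ ^ (e DivMod.% Q)) * 1# ≡⟨ *-identityʳ _ ⟩
    ξ ^ (e DivMod.% Q) ∎

  ^Q≡1 : ∀ {x} → ¬ x ≡ 0# → x ^ Q ≡ 1#
  ^Q≡1 x≢0 with e , _ , refl ← log x≢0 = trans (sym (^-* ξ e Q)) (trans (cong (ξ ^_) (ℕₚ.*-comm e Q)) (ξ^-Q* e))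

  quadratic-roots : ∀ a b c (xs : List Carrier) → Unique xs → All (λ x → (a * x + b) * x + c ≡ 0#) xs → 3 ℕ.≤ length xs →
    a ≡ 0# × b ≡ 0# × c ≡ 0#
  quadratic-roots a b c xs unique roots 3≤ = p≡0 2 , p≡0 1 , p≡0 0
    where
    p : Poly
    p 0 = c
    p 1 = b
    p 2 = a
    p (suc (suc (suc _))) = 0#
    p-bounded : Bounded 3 p
    p-bounded (suc (suc (suc k))) _ = refl
    p-bounded 1 (s≤s ())
    p-bounded 2 (s≤s (s≤s ()))
    eval-p : ∀ x → eval x 3 p ≡ (a * x + b) * x + c
    eval-p x = begin
      eval x 3 p ≡⟨ eval-suc x 2 p ⟩
      c + x * eval x 2 (p ∘ suc) ≡⟨ cong (λ y → c + x * y) (eval-suc x 1 (p ∘ suc)) ⟩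
      c + x * (b + x * eval x 1 (p ∘ suc ∘ suc)) ≡⟨ cong (λ y → c + x * (b + x * y)) (trans (+-identityʳ _) (*-identityʳ a)) ⟩
      c + x * (b + x * a) ≡⟨ solve 4 (λ a b c x → c :+ x :* (b :+ x :* a) := (a :* x :+ b) :* x :+ c) refl a b c x ⟩
      (a * x + b) * x + c ∎
    p≡0 : ∀ k → p k ≡ 0#
    p≡0 = roots-bound 3 (map (_, 1) xs) p-bounded (AllPairsₚ.map⁺ unique)
      (Allₚ.map⁺ (All.map (λ { {x} root zero _ → trans (eval-p x) root ; _ (suc _) (s≤s ()) }) roots))
      (ℕₚ.≤-trans 3≤ (ℕₚ.≤-reflexive (sym (multiplicities xs))))
      where
      multiplicities : ∀ xs → sum-ℕ (map proj₂ (map (λ x → x , 1) xs)) ≡ length xs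
      multiplicities []       = refl
      multiplicities (x ∷ xs) = cong suc (multiplicities xs)

  covering-length : (xs : List Carrier) → (∀ x → x ∈ xs) → q ℕ.≤ length xs
  covering-length xs covers = Finₚ.injective⇒≤ {f = λ i → index (covers (to i))}
    λ {i} {j} eq → to-injective (trans (lookup-index (covers (to i))) (trans (cong (lookup xs) eq) (sym (lookup-index (covers (to j))))))

  exponent-list-unique : ∀ {p} {P : ℕ → Set p} (P? : ∀ e → Dec (P e)) → Unique (map (ξ ^_) (filter P? (upTo Q)))
  exponent-list-unique P? = AllPairsₚ.map⁺ (AllPairsₚ.filter⁺ P? (AllPairsₚ.applyUpTo⁺₁ (λ e → e) Q (λ i<j j<Q → ξ^-distinct i<j j<Q)))

-- Carlitz forms as Moebius maps up to few exceptions.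

module Moebius (F : FiniteField) (α β γ δ : FiniteField.Carrier F) where

  open FiniteField F
  open FieldProperties F
  open ≡-Reasoning

  numerator denominator : Carrier → Carrier
  numerator x = α * x + β
  denominator x = γ * x + δ

  -- The multiplied-out form keeps the convention `0# ⁻¹ = 0#` out of the comparison: a pole of the
  -- Moebius map never counts as agreement.
  Agrees : (Carrier → Carrier) → Carrier → Set
  Agrees f x = ¬ denominator x ≡ 0# × f x * denominator x ≡ numerator x

  agrees? : ∀ f x → Dec (Agrees f x)
  agrees? f x = ¬? (denominator x ≟ 0#) ×-dec ((f x * denominator x) ≟ numerator x)

module CarlitzApproximation (F : FiniteField) where

  open FiniteField F
  open FieldProperties F
  open ≡-Reasoning

  -- `poles` lists possible exceptions. Repetitions, and points where agreement holds after all, are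
  -- allowed; only the length is used for counting.
  record Approximation (f : Carrier → Carrier) (n : ℕ) : Set where
    field
      α β γ δ       : Carrier
      nonsingular   : ¬ α * δ ≡ β * γ
      poles         : List Carrier
      length-poles  : length poles ≡ n
      approximates  : ∀ x → x ∈ poles ⊎ Moebius.Agrees F α β γ δ f x

  -- Inverting exchanges numerator and denominator, and adding `k` is a row operation, so the
  -- determinant only changes sign. The inversion can fail to match only at the root of the old
  -- numerator, so each one costs at most one point.
  carlitz-approximation : ∀ n c → ¬ c 0 ≡ 0# → Approximation (carlitzInner F n c) n
  carlitz-approximation zero c c₀≢0 = record
    { α = c 0 ; β = c 1 ; γ = 0# ; δ = 1#
    ; nonsingular = λ eq → c₀≢0 (trans (sym (*-identityʳ _)) (trans eq (zeroʳ _)))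
    ; poles = []
    ; length-poles = refl
    ; approximates = λ x → inj₂ ((λ eq → 1≢0 (trans (sym (denominator≡1 x)) eq)) , trans (*-congˡ (denominator≡1 x)) (*-identityʳ _))
    }
    where
    denominator≡1 : ∀ x → 0# * x + 1# ≡ 1#
    denominator≡1 x = trans (cong (_+ 1#) (zeroˡ x)) (+-identityˡ 1#)
  carlitz-approximation (suc n) c c₀≢0 = record
    { α = γ + k * α ; β = δ + k * β ; γ = α ; δ = β
    ; nonsingular = λ eq → nonsingular (sym (+-cancelˡ (k * (α * β)) _ _ (begin
        k * (α * β) + β * γ ≡⟨ solve 4 (λ k a b g → k :* (a :* b) :+ b :* g := (g :+ k :* a) :* b) refl k α β γ ⟩
        (γ + k * α) * β     ≡⟨ eq ⟩
        (δ + k * β) * α     ≡⟨ solve 4 (λ k a b d → (d :+ k :* b) :* a := k :* (a :* b) :+ a :* d) refl k α β δ ⟩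
        k * (α * β) + α * δ ∎)))
    ; poles = root ∷ poles
    ; length-poles = cong suc length-poles
    ; approximates = approximates′
    }
    where
    open Approximation (carlitz-approximation n c c₀≢0)
    open Moebius F α β γ δ using (numerator; denominator)
    k = c (suc (suc n))
    -- For `α = 0#` the numerator is a nonzero constant without a root; the formula then gives `0#`,
    -- a harmless filler that keeps the length exact.
    root = (α ⁻¹) * - β
    root-unique : ∀ x → numerator x ≡ 0# → x ≡ root
    root-unique x eq with α ≟ 0#
    ... | yes α≡0 = contradiction (trans (trans (cong (_* δ) α≡0) (zeroˡ δ)) (sym (trans (cong (_* γ) β≡0) (zeroˡ γ)))) nonsingular
      where
      β≡0 : β ≡ 0#
      β≡0 = trans (sym (+-identityˡ β)) (trans (cong (_+ β) (sym (trans (cong (_* x) α≡0) (zeroˡ x)))) eq)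
    ... | no α≢0 = trans (sym (⁻¹-cancelˡ x α≢0)) (cong ((α ⁻¹) *_) (+-inverseʳ-unique β (α * x) (trans (+-comm _ _) eq)))
    step : ∀ x → ¬ numerator x ≡ 0# → Moebius.Agrees F α β γ δ (carlitzInner F n c) x →
      Moebius.Agrees F (γ + k * α) (δ + k * β) α β (carlitzInner F (suc n) c) x
    step x N≢0 (D≢0 , agree) = N≢0 , (begin
      ((y ⁻¹) + k) * numerator x               ≡⟨ distribʳ _ _ _ ⟩
      (y ⁻¹) * numerator x + k * numerator x   ≡⟨ +-congʳ (trans (*-congˡ (sym agree)) (⁻¹-cancelˡ _ y≢0)) ⟩
      denominator x + k * numerator x          ≡⟨ solve 6 (λ a b g d k x → (g :* x :+ d) :+ k :* (a :* x :+ b) := (g :+ k :* a) :* x :+ (d :+ k :* b)) refl α β γ δ k x ⟩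
      (γ + k * α) * x + (δ + k * β) ∎)
      where
      y = carlitzInner F n c x
      y≢0 : ¬ y ≡ 0#
      y≢0 y≡0 = N≢0 (trans (sym agree) (trans (cong (_* denominator x) y≡0) (zeroˡ _)))
    approximates′ : ∀ x → x ∈ root ∷ poles ⊎ Moebius.Agrees F (γ + k * α) (δ + k * β) α β (carlitzInner F (suc n) c) x
    approximates′ x with approximates x | numerator x ≟ 0#
    ... | inj₁ x∈ | _        = inj₁ (there x∈)
    ... | inj₂ _  | yes N≡0 = inj₁ (here (root-unique x N≡0))
    ... | inj₂ ag | no N≢0  = inj₂ (step x N≢0 ag)

-- Agreement of a cyclotomic mapping with a Moebius map.

module CyclotomicMapping
  (F : FiniteField) (ξ : FiniteField.Carrier F) (ξ-primitive : IsPrimitive F ξ)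
  (ℓ : ℕ) .{{_ : ℕ.NonZero ℓ}} (ℓ∣Q : ℓ ∣ (FiniteField.q F ℕ.∸ 1)) (r : ℕ)
  (a : Fin ℓ → FiniteField.Carrier F) (j : ℕ) (a∈C : ∀ i → InCoset F ξ ℓ j (a i))
  (f : FiniteField.Carrier F → FiniteField.Carrier F)
  (f-on-cosets : ∀ i x → InCoset F ξ ℓ (toℕ i) x → f x ≡ FiniteField._*_ F (a i) (FiniteField._^_ F x r))
  where

  open FiniteField F
  open FieldProperties F
  open Stepanov F
  open PrimitiveElement F ξ ξ-primitive
  open NatCounting using (indicator; indicator-×; sum-indicator; pair-count) renaming (sum to ∑ℕ; sum-cong-≗ to ∑ℕ-cong)
  open ≡-Reasoning

  0<Q : 0 ℕ.< Q
  0<Q = ℕₚ.m<n⇒0<n∸m 1<q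

  instance
    Q-nonZero : ℕ.NonZero Q
    Q-nonZero = ℕ.>-nonZero 0<Q

  m : ℕ
  m = Q DivMod./ ℓ

  Q≡mℓ : Q ≡ m ℕ.* ℓ
  Q≡mℓ = sym (DivMod.m/n*n≡m ℓ∣Q)

  Q≡ℓm : Q ≡ ℓ ℕ.* m
  Q≡ℓm = trans Q≡mℓ (ℕₚ.*-comm m ℓ)

  0<m : 0 ℕ.< m
  0<m = ℕₚ.n≢0⇒n>0 λ m≡0 → ℕₚ.<⇒≢ 0<Q (sym (trans Q≡mℓ (cong (ℕ._* ℓ) m≡0)))

  instance
    m-nonZero : ℕ.NonZero m
    m-nonZero = ℕ.>-nonZero 0<m

  1+pred[m]≡m : suc (ℕ.pred m) ≡ m
  1+pred[m]≡m = ℕₚ.suc-pred m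

  A : ℕ → Carrier
  A e = a (e DivMod.mod ℓ)

  toℕ-mod : ∀ e → toℕ (e DivMod.mod ℓ) ≡ e DivMod.% ℓ
  toℕ-mod e = Finₚ.toℕ-fromℕ< (DivMod.m%n<n e ℓ)

  A-periodic : ∀ e k → A (e ℕ.+ k ℕ.* ℓ) ≡ A e
  A-periodic e k = cong a (Finₚ.toℕ-injective (trans (toℕ-mod (e ℕ.+ k ℕ.* ℓ)) (trans (DivMod.[m+kn]%n≡m%n e k ℓ) (sym (toℕ-mod e)))))

  -- `InCoset` bounds the inner exponent by `m`, so `e` is first reduced modulo `Q`; since `ℓ`
  -- divides `Q`, its residue modulo `ℓ` survives.
  f-on-powers : ∀ e → f (ξ ^ e) ≡ A e * ((ξ ^ e) ^ r)
  f-on-powers e = f-on-cosets (e DivMod.mod ℓ) (ξ ^ e) (e′ DivMod./ ℓ , DivMod.m<n*o⇒m/o<n (subst (e′ ℕ.<_) Q≡mℓ (DivMod.m%n<n e Q)) , (begin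
    ξ ^ e  ≡⟨ ξ^-% e ⟩
    ξ ^ e′ ≡⟨ cong (ξ ^_) (DivMod.m≡m%n+[m/n]*n e′ ℓ) ⟩
    ξ ^ (e′ DivMod.% ℓ ℕ.+ e′ DivMod./ ℓ ℕ.* ℓ)
      ≡⟨ cong (λ i → ξ ^ (i ℕ.+ e′ DivMod./ ℓ ℕ.* ℓ)) (trans (DivMod.m∣n⇒o%n%m≡o%m ℓ Q e ℓ∣Q) (sym (toℕ-mod e))) ⟩
    ξ ^ (toℕ (e DivMod.mod ℓ) ℕ.+ e′ DivMod./ ℓ ℕ.* ℓ) ∎))
    where
    e′ = e DivMod.% Q

  a≢0 : ∀ i → ¬ a i ≡ 0#
  a≢0 i with k , _ , eq ← a∈C i = λ a≡0 → ξ^≢0 (j ℕ.+ k ℕ.* ℓ) (trans (sym eq) a≡0)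

  -- The power `m` is trivial on `C₀`, so it depends only on the coset. As all `a i` share one
  -- coset, a single `κ` serves all of them and one curve contains every agreement point.
  a^m : ∀ i → a i ^ m ≡ ξ ^ (j ℕ.* m)
  a^m i with k , _ , eq ← a∈C i = begin
    a i ^ m                                   ≡⟨ cong (_^ m) eq ⟩
    (ξ ^ (j ℕ.+ k ℕ.* ℓ)) ^ m                 ≡⟨ ^-* ξ (j ℕ.+ k ℕ.* ℓ) m ⟨
    ξ ^ ((j ℕ.+ k ℕ.* ℓ) ℕ.* m)               ≡⟨ cong (ξ ^_) exponent ⟩
    ξ ^ (j ℕ.* m ℕ.+ Q ℕ.* k)                 ≡⟨ ^-+ ξ (j ℕ.* m) (Q ℕ.* k) ⟩
    (ξ ^ (j ℕ.* m)) * (ξ ^ (Q ℕ.* k))         ≡⟨ trans (*-congˡ (ξ^-Q* k)) (*-identityʳ _) ⟩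
    ξ ^ (j ℕ.* m)                             ∎
    where
    open NatSolver.+-*-Solver renaming (solve to solveℕ; _:+_ to _⊕_; _:=_ to _⊜_; _:*_ to _⊗_)
    exponent : (j ℕ.+ k ℕ.* ℓ) ℕ.* m ≡ j ℕ.* m ℕ.+ Q ℕ.* k
    exponent = trans (solveℕ 4 (λ j k l m → (j ⊕ k ⊗ l) ⊗ m ⊜ j ⊗ m ⊕ (m ⊗ l) ⊗ k) refl j k ℓ m) (cong (λ Q → j ℕ.* m ℕ.+ Q ℕ.* k) (sym Q≡mℓ))

  κ : Carrier
  κ = ξ ^ (j ℕ.* m)

  f-nonzero : ∀ {x} → ¬ x ≡ 0# → ¬ f x ≡ 0#
  f-nonzero x≢0 with e , _ , refl ← log x≢0 = λ eq →
    *-nonzero (a≢0 (e DivMod.mod ℓ)) (^-nonzero r x≢0) (trans (sym (f-on-powers e)) eq)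

  f^m : ∀ {x} → ¬ x ≡ 0# → f x ^ m ≡ κ * (x ^ (m ℕ.* r))
  f^m x≢0 with e , _ , refl ← log x≢0 = begin
    f (ξ ^ e) ^ m                       ≡⟨ cong (_^ m) (f-on-powers e) ⟩
    (A e * ((ξ ^ e) ^ r)) ^ m           ≡⟨ ^-*ˡ (A e) ((ξ ^ e) ^ r) m ⟩
    (A e ^ m) * (((ξ ^ e) ^ r) ^ m)     ≡⟨ cong₂ _*_ (a^m (e DivMod.mod ℓ)) (trans (sym (^-* (ξ ^ e) r m)) (cong ((ξ ^ e) ^_) (ℕₚ.*-comm r m))) ⟩
    κ * ((ξ ^ e) ^ (m ℕ.* r))           ∎

  -- In the coordinate s = α x + β, both x and γ x + δ are linear functions of s with nonzero constant term.
  linear-forms-bound : ∀ {α β γ δ} → ¬ α ≡ 0# → ¬ β ≡ 0# → ¬ α * δ ≡ β * γ → ∀ g κ (xs : List Carrier) → Unique xs →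
    All (λ x → ¬ x ≡ 0# × ¬ α * x + β ≡ 0# × ¬ γ * x + δ ≡ 0# × ((α * x + β) ^ m) * (x ^ (m ℕ.* g)) ≡ κ * ((γ * x + δ) ^ m)) xs →
    ∀ M → suc M ℕ.* (m ℕ.+ M) ℕ.< Q → length xs ℕ.* suc M ℕ.< Q ℕ.+ Q
  linear-forms-bound {α} {β} {γ} {δ} α≢0 β≢0 nonsingular g κ xs unique points M M< =
    subst (λ n → n ℕ.* suc M ℕ.< Q ℕ.+ Q) (Listₚ.length-map s xs)
      (AuxiliaryPolynomial.stepanov Q m ℓ Q≡ℓm ^Q≡1 b₁≢0 b₂≢0 g κ (map s xs)
        (AllPairsₚ.map⁺ (AllPairs.map (λ x≢y eq → x≢y (s-injective eq)) unique))
        (Allₚ.map⁺ (All.map transfer points)) M M<)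
    where
    s : Carrier → Carrier
    s x = α * x + β
    a₁ = α ⁻¹
    b₁ = (α ⁻¹) * - β
    a₂ = γ * a₁
    b₂ = γ * b₁ + δ
    open Products a₁ b₁ a₂ b₂
    X-s : ∀ x → X (s x) ≡ x
    X-s x = begin
      a₁ * (α * x + β) + a₁ * - β ≡⟨ distribˡ a₁ _ _ ⟨
      a₁ * (α * x + β + - β)      ≡⟨ *-congˡ (trans (+-assoc _ _ _) (trans (+-congˡ (-‿inverseʳ β)) (+-identityʳ _))) ⟩
      a₁ * (α * x)                ≡⟨ ⁻¹-cancelˡ x α≢0 ⟩
      x ∎
    Y-s : ∀ x → Y (s x) ≡ γ * x + δ
    Y-s x = trans (solve 5 (λ g a s b d → g :* a :* s :+ (g :* b :+ d) := g :* (a :* s :+ b) :+ d) refl γ a₁ (s x) b₁ δ)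
      (cong (λ y → γ * y + δ) (X-s x))
    s-injective : ∀ {x y} → s x ≡ s y → x ≡ y
    s-injective {x} {y} eq = trans (sym (X-s x)) (trans (cong X eq) (X-s y))
    b₁≢0 : ¬ b₁ ≡ 0#
    b₁≢0 eq = β≢0 (begin
      β          ≡⟨ +-identityʳ β ⟨
      β + 0#     ≡⟨ +-congˡ (xy≡0⇒y≡0 (⁻¹-nonzero α≢0) eq) ⟨
      β + - β    ≡⟨ -‿inverseʳ β ⟩
      0#         ∎)
    αb₁≡-β : α * b₁ ≡ - β
    αb₁≡-β = trans (sym (*-assoc _ _ _)) (trans (*-congʳ (⁻¹-inverse α α≢0)) (*-identityˡ _))
    -- Here `α * b₂` is the determinant `α δ - β γ`.
    b₂≢0 : ¬ b₂ ≡ 0#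
    b₂≢0 eq = nonsingular (+-cancelˡ (γ * - β) _ _ (begin
      γ * - β + α * δ      ≡⟨ cong (λ y → γ * y + α * δ) αb₁≡-β ⟨
      γ * (α * b₁) + α * δ ≡⟨ solve 4 (λ g a b d → g :* (a :* b) :+ a :* d := a :* (g :* b :+ d)) refl γ α b₁ δ ⟩
      α * b₂               ≡⟨ trans (*-congˡ eq) (zeroʳ α) ⟩
      0#                   ≡⟨ trans (*-congˡ (-‿inverseˡ β)) (zeroʳ γ) ⟨
      γ * (- β + β)        ≡⟨ solve 3 (λ g n b → g :* (n :+ b) := g :* n :+ b :* g) refl γ (- β) β ⟩
      γ * - β + β * γ      ∎))
    transfer : ∀ {x} → ¬ x ≡ 0# × ¬ s x ≡ 0# × ¬ γ * x + δ ≡ 0# × (s x ^ m) * (x ^ (m ℕ.* g)) ≡ κ * ((γ * x + δ) ^ m) →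
      ¬ s x ≡ 0# × ¬ X (s x) ≡ 0# × ¬ Y (s x) ≡ 0# × (s x ^ m) * (X (s x) ^ (m ℕ.* g)) ≡ κ * (Y (s x) ^ m)
    transfer {x} (x≢0 , s≢0 , y≢0 , eq) =
      s≢0 , (λ e → x≢0 (trans (sym (X-s x)) e)) , (λ e → y≢0 (trans (sym (Y-s x)) e)) ,
      trans (cong (λ y → (s x ^ m) * (y ^ (m ℕ.* g))) (X-s x)) (trans eq (cong (λ y → κ * (y ^ m)) (sym (Y-s x))))

  module Agreement (α β γ δ : Carrier) (nonsingular : ¬ α * δ ≡ β * γ)
    (nondegenerate : (¬ α ≡ 0# × ¬ β ≡ 0#) ⊎ (¬ γ ≡ 0# × ¬ δ ≡ 0#)) where

    open Moebius F α β γ δ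

    agreeing : List ℕ
    agreeing = filter (λ e → agrees? f (ξ ^ e)) (upTo Q)

    K : ℕ
    K = length agreeing

    numerator≢0 : ∀ {x} → ¬ x ≡ 0# → Agrees f x → ¬ numerator x ≡ 0#
    numerator≢0 x≢0 (D≢0 , eq) N≡0 = *-nonzero (f-nonzero x≢0) D≢0 (trans eq N≡0)

    powers-agree : ∀ {x} → ¬ x ≡ 0# → Agrees f x → numerator x ^ m ≡ κ * (x ^ (m ℕ.* r)) * (denominator x ^ m)
    powers-agree x≢0 (_ , eq) = trans (cong (_^ m) (sym eq)) (trans (^-*ˡ _ _ m) (*-congʳ (f^m x≢0)))

    points : All (λ x → ¬ x ≡ 0# × Agrees f x) (map (ξ ^_) agreeing)
    points = Allₚ.map⁺ (All.map (λ {e} agrees → ξ^≢0 e , agrees) (Allₚ.all-filter (λ e → agrees? f (ξ ^ e)) (upTo Q)))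

    points-unique : Unique (map (ξ ^_) agreeing)
    points-unique = exponent-list-unique (λ e → agrees? f (ξ ^ e))

    -- Numerator and denominator play symmetric roles on the curve; the coordinate is whichever of
    -- them has both coefficients nonzero.
    points-bound : ∀ M → suc M ℕ.* (m ℕ.+ M) ℕ.< Q → K ℕ.* suc M ℕ.< Q ℕ.+ Q
    points-bound M M< = subst (λ n → n ℕ.* suc M ℕ.< Q ℕ.+ Q) (Listₚ.length-map (ξ ^_) agreeing) (bound nondegenerate)
      where
      xs = map (ξ ^_) agreeing
      κ≢0 : ¬ κ ≡ 0#
      κ≢0 = ξ^≢0 (j ℕ.* m)
      bound : (¬ α ≡ 0# × ¬ β ≡ 0#) ⊎ (¬ γ ≡ 0# × ¬ δ ≡ 0#) → length xs ℕ.* suc M ℕ.< Q ℕ.+ Q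
      -- The relation needs `x` to the power `- m r`; as `x ^ Q` is 1, this is the power
      -- `m r (Q - 1)`.
      bound (inj₁ (α≢0 , β≢0)) = linear-forms-bound α≢0 β≢0 nonsingular (r ℕ.* ℕ.pred Q) κ xs points-unique
        (All.map (λ { {x} (x≢0 , ag) → x≢0 , numerator≢0 x≢0 ag , proj₁ ag , relation x≢0 ag }) points) M M<
        where
        relation : ∀ {x} → ¬ x ≡ 0# → Agrees f x → (numerator x ^ m) * (x ^ (m ℕ.* (r ℕ.* ℕ.pred Q))) ≡ κ * (denominator x ^ m)
        relation {x} x≢0 ag = begin
          (numerator x ^ m) * (x ^ (m ℕ.* (r ℕ.* ℕ.pred Q)))
            ≡⟨ *-congʳ (powers-agree x≢0 ag) ⟩
          κ * (x ^ (m ℕ.* r)) * (denominator x ^ m) * (x ^ (m ℕ.* (r ℕ.* ℕ.pred Q)))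
            ≡⟨ solve 4 (λ k x d y → k :* x :* d :* y := k :* d :* (x :* y)) refl κ (x ^ (m ℕ.* r)) (denominator x ^ m) _ ⟩
          κ * (denominator x ^ m) * ((x ^ (m ℕ.* r)) * (x ^ (m ℕ.* (r ℕ.* ℕ.pred Q))))
            ≡⟨ *-congˡ (begin
              (x ^ (m ℕ.* r)) * (x ^ (m ℕ.* (r ℕ.* ℕ.pred Q))) ≡⟨ ^-+ x (m ℕ.* r) _ ⟨
              x ^ (m ℕ.* r ℕ.+ m ℕ.* (r ℕ.* ℕ.pred Q))         ≡⟨ cong (x ^_) exponent ⟩
              x ^ (Q ℕ.* (m ℕ.* r))                            ≡⟨ ^-* x Q (m ℕ.* r) ⟩
              (x ^ Q) ^ (m ℕ.* r)                              ≡⟨ trans (cong (_^ (m ℕ.* r)) (^Q≡1 x≢0)) (1^n≡1 (m ℕ.* r)) ⟩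
              1# ∎) ⟩
          κ * (denominator x ^ m) * 1# ≡⟨ *-identityʳ _ ⟩
          κ * (denominator x ^ m) ∎
          where
          open NatSolver.+-*-Solver renaming (solve to solveℕ; _:+_ to _⊕_; _:=_ to _⊜_; _:*_ to _⊗_; con to conℕ)
          exponent : m ℕ.* r ℕ.+ m ℕ.* (r ℕ.* ℕ.pred Q) ≡ Q ℕ.* (m ℕ.* r)
          exponent = trans (solveℕ 3 (λ m r p → m ⊗ r ⊕ m ⊗ (r ⊗ p) ⊜ (conℕ 1 ⊕ p) ⊗ (m ⊗ r)) refl m r (ℕ.pred Q)) (cong (ℕ._* (m ℕ.* r)) (ℕₚ.suc-pred Q))
      -- With the two forms exchanged, the power of `x` is already on the right side and `κ` is
      -- inverted instead.
      bound (inj₂ (γ≢0 , δ≢0)) = linear-forms-bound γ≢0 δ≢0 (λ eq → nonsingular (trans (*-comm α δ) (trans (sym eq) (*-comm γ β)))) r (κ ⁻¹) xs points-unique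
        (All.map (λ { {x} (x≢0 , ag) → x≢0 , proj₁ ag , numerator≢0 x≢0 ag , relation x≢0 ag }) points) M M<
        where
        relation : ∀ {x} → ¬ x ≡ 0# → Agrees f x → (denominator x ^ m) * (x ^ (m ℕ.* r)) ≡ (κ ⁻¹) * (numerator x ^ m)
        relation {x} x≢0 ag = sym (begin
          (κ ⁻¹) * (numerator x ^ m)                          ≡⟨ *-congˡ (trans (powers-agree x≢0 ag) (*-assoc _ _ _)) ⟩
          (κ ⁻¹) * (κ * ((x ^ (m ℕ.* r)) * (denominator x ^ m))) ≡⟨ ⁻¹-cancelˡ _ κ≢0 ⟩
          (x ^ (m ℕ.* r)) * (denominator x ^ m)               ≡⟨ *-comm _ _ ⟩
          (denominator x ^ m) * (x ^ (m ℕ.* r))               ∎)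

    -- If f (x u) = B U and f (x v) = B V, then eliminating B leaves a quadratic equation for x.
    module Elimination (u v U V : Carrier) where

      W c₂ c₁ c₀ : Carrier
      W  = - U
      c₂ = γ * α * (u * v) * (V + W)
      c₁ = V * (γ * v * β + δ * α * u) + W * (γ * u * β + δ * α * v)
      c₀ = β * δ * (V + W)

      quadratic : ∀ B x → ¬ B ≡ 0# → B * U * denominator (x * u) ≡ numerator (x * u) → B * V * denominator (x * v) ≡ numerator (x * v) →
        (c₂ * x + c₁) * x + c₀ ≡ 0#
      quadratic B x B≢0 atU atV = begin
        (c₂ * x + c₁) * x + c₀
          ≡⟨ solve 9 (λ a b g d u v V W x →
               (g :* a :* (u :* v) :* (V :+ W) :* x :+ (V :* (g :* v :* b :+ d :* a :* u) :+ W :* (g :* u :* b :+ d :* a :* v))) :* x :+ b :* d :* (V :+ W)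
               := V :* ((g :* (x :* v) :+ d) :* (a :* (x :* u) :+ b)) :+ W :* ((g :* (x :* u) :+ d) :* (a :* (x :* v) :+ b)))
               refl α β γ δ u v V W x ⟩
        V * (denominator (x * v) * numerator (x * u)) + W * (denominator (x * u) * numerator (x * v))
          ≡⟨ +-congʳ (*-cancelˡ-nonzero B B≢0 cross) ⟩
        U * (denominator (x * u) * numerator (x * v)) + W * (denominator (x * u) * numerator (x * v))
          ≡⟨ distribʳ _ U W ⟨
        (U + W) * (denominator (x * u) * numerator (x * v))
          ≡⟨ trans (*-congʳ (-‿inverseʳ U)) (zeroˡ _) ⟩
        0# ∎
        where
        cross : B * (V * (denominator (x * v) * numerator (x * u))) ≡ B * (U * (denominator (x * u) * numerator (x * v)))
        cross = begin
          B * (V * (denominator (x * v) * numerator (x * u))) ≡⟨ solve 4 (λ B V d n → B :* (V :* (d :* n)) := (B :* V :* d) :* n) refl B V (denominator (x * v)) (numerator (x * u)) ⟩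
          B * V * denominator (x * v) * numerator (x * u)     ≡⟨ cong₂ _*_ atV (sym atU) ⟩
          numerator (x * v) * (B * U * denominator (x * u))   ≡⟨ solve 4 (λ B U d n → n :* (B :* U :* d) := B :* (U :* (d :* n))) refl B U (denominator (x * u)) (numerator (x * v)) ⟩
          B * (U * (denominator (x * u) * numerator (x * v))) ∎

      -- If `U = V`, the middle coefficient is `V (α δ - β γ) (u - v)`, which is nonzero. Otherwise
      -- vanishing outer coefficients give `γ α = 0` and `β δ = 0`; with one form having both
      -- coefficients nonzero, the other form would be zero, against nonsingularity.
      nontrivial : ¬ u ≡ 0# → ¬ v ≡ 0# → ¬ u ≡ v → ¬ V ≡ 0# → ¬ (c₂ ≡ 0# × c₁ ≡ 0# × c₀ ≡ 0#)
      nontrivial u≢0 v≢0 u≢v V≢0 (c₂≡0 , c₁≡0 , c₀≡0) with V ≟ U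
      ... | yes refl = u≢v (x-y≡0⇒x≡y u v (xy≡0⇒y≡0 det≢0 (begin
          det * (u + - v) ≡⟨ distribʳ _ _ _ ⟩
          α * δ * (u + - v) + - (β * γ) * (u + - v) ≡⟨ +-congʳ αδ≡βγ ⟩
          β * γ * (u + - v) + - (β * γ) * (u + - v) ≡⟨ distribʳ _ _ _ ⟨
          (β * γ + - (β * γ)) * (u + - v) ≡⟨ trans (*-congʳ (-‿inverseʳ _)) (zeroˡ _) ⟩
          0# ∎)))
        where
        det = α * δ + - (β * γ)
        det≢0 : ¬ det ≡ 0#
        det≢0 eq = nonsingular (x-y≡0⇒x≡y _ _ eq)
        equal : γ * v * β + δ * α * u ≡ γ * u * β + δ * α * v
        equal = *-cancelˡ-nonzero V V≢0 (x-y≡0⇒x≡y _ _ (trans (+-congˡ (-‿distribˡ-* V _)) c₁≡0))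
        αδ≡βγ : α * δ * (u + - v) ≡ β * γ * (u + - v)
        αδ≡βγ = +-cancelˡ (γ * v * β + δ * α * v) _ _ (begin
          (γ * v * β + δ * α * v) + α * δ * (u + - v)
            ≡⟨ solve 6 (λ a b d g v w → (g :* v :* b :+ d :* a :* v) :+ a :* d :* w := g :* v :* b :+ d :* a :* (v :+ w)) refl α β δ γ v (u + - v) ⟩
          γ * v * β + δ * α * (v + (u + - v)) ≡⟨ cong (λ y → γ * v * β + δ * α * y) v+u-v ⟩
          γ * v * β + δ * α * u ≡⟨ equal ⟩
          γ * u * β + δ * α * v ≡⟨ cong (λ y → γ * y * β + δ * α * v) v+u-v ⟨
          γ * (v + (u + - v)) * β + δ * α * v
            ≡⟨ solve 6 (λ a b d g v w → g :* (v :+ w) :* b :+ d :* a :* v := (g :* v :* b :+ d :* a :* v) :+ b :* g :* w) refl α β δ γ v (u + - v) ⟩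
          (γ * v * β + δ * α * v) + β * γ * (u + - v) ∎)
          where
          v+u-v : v + (u + - v) ≡ u
          v+u-v = trans (solve 3 (λ v u w → v :+ (u :+ w) := u :+ (v :+ w)) refl v u (- v)) (trans (+-congˡ (-‿inverseʳ v)) (+-identityʳ u))
      ... | no V≢U = singular nondegenerate
        where
        V+W≢0 : ¬ V + W ≡ 0#
        V+W≢0 eq = V≢U (x-y≡0⇒x≡y V U eq)
        γα≡0 : γ * α ≡ 0#
        γα≡0 = xy≡0⇒y≡0 (*-nonzero (*-nonzero u≢0 v≢0) V+W≢0) (trans (trans (*-comm _ _) (sym (*-assoc _ _ _))) c₂≡0)
        βδ≡0 : β * δ ≡ 0#
        βδ≡0 = xy≡0⇒y≡0 V+W≢0 (trans (*-comm _ _) c₀≡0)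
        singular : ¬ ((¬ α ≡ 0# × ¬ β ≡ 0#) ⊎ (¬ γ ≡ 0# × ¬ δ ≡ 0#))
        singular (inj₁ (α≢0 , β≢0)) = nonsingular (trans (trans (*-congˡ (xy≡0⇒y≡0 β≢0 βδ≡0)) (zeroʳ α))
          (sym (trans (*-congˡ (xy≡0⇒y≡0 α≢0 (trans (*-comm α γ) γα≡0))) (zeroʳ β))))
        singular (inj₂ (γ≢0 , δ≢0)) = nonsingular (trans (trans (*-congʳ (xy≡0⇒y≡0 γ≢0 γα≡0)) (zeroˡ δ))
          (sym (trans (*-congʳ (xy≡0⇒y≡0 δ≢0 (trans (*-comm δ β) βδ≡0))) (zeroˡ γ))))

    f-shifted : ∀ e k → f (ξ ^ (e ℕ.+ k ℕ.* ℓ)) ≡ A e * ((ξ ^ e) ^ r) * ((ξ ^ (k ℕ.* ℓ)) ^ r)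
    f-shifted e k = begin
      f (ξ ^ (e ℕ.+ k ℕ.* ℓ)) ≡⟨ f-on-powers (e ℕ.+ k ℕ.* ℓ) ⟩
      A (e ℕ.+ k ℕ.* ℓ) * ((ξ ^ (e ℕ.+ k ℕ.* ℓ)) ^ r) ≡⟨ cong₂ (λ x y → x * (y ^ r)) (A-periodic e k) (^-+ ξ e (k ℕ.* ℓ)) ⟩
      A e * (((ξ ^ e) * (ξ ^ (k ℕ.* ℓ))) ^ r) ≡⟨ *-congˡ (^-*ˡ _ _ r) ⟩
      A e * (((ξ ^ e) ^ r) * ((ξ ^ (k ℕ.* ℓ)) ^ r)) ≡⟨ *-assoc _ _ _ ⟨
      A e * ((ξ ^ e) ^ r) * ((ξ ^ (k ℕ.* ℓ)) ^ r) ∎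

    agrees-shifted : ∀ e k → Agrees f (ξ ^ (e ℕ.+ k ℕ.* ℓ)) →
      A e * ((ξ ^ e) ^ r) * ((ξ ^ (k ℕ.* ℓ)) ^ r) * denominator ((ξ ^ e) * (ξ ^ (k ℕ.* ℓ))) ≡ numerator ((ξ ^ e) * (ξ ^ (k ℕ.* ℓ)))
    agrees-shifted e k (_ , eq) = trans (cong₂ (λ x y → x * denominator y) (sym (f-shifted e k)) (sym (^-+ ξ e (k ℕ.* ℓ))))
      (trans eq (cong numerator (^-+ ξ e (k ℕ.* ℓ))))

    coset-points-distinct : ∀ {k k′} → k ℕ.< m → k′ ℕ.< m → ¬ k ≡ k′ → ¬ ξ ^ (k ℕ.* ℓ) ≡ ξ ^ (k′ ℕ.* ℓ)
    coset-points-distinct {k} {k′} k<m k′<m k≢k′ eq with ℕₚ.<-cmp k k′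
    ... | tri< k<k′ _ _ = ξ^-distinct (ℕₚ.*-monoˡ-< ℓ k<k′) (subst (k′ ℕ.* ℓ ℕ.<_) (sym Q≡mℓ) (ℕₚ.*-monoˡ-< ℓ k′<m)) eq

    ... | tri≈ _ k≡k′ _ = k≢k′ k≡k′
    ... | tri> _ _ k′<k = ξ^-distinct (ℕₚ.*-monoˡ-< ℓ k′<k) (subst (k ℕ.* ℓ ℕ.<_) (sym Q≡mℓ) (ℕₚ.*-monoˡ-< ℓ k<m)) (sym eq)

    χ : ℕ → ℕ
    χ e = indicator (agrees? f (ξ ^ e))

    -- Multiplying `ξ ^ e` by an element of `C₀` keeps the same `a i`, so both values of `f` share
    -- the factor `B = A e * ((ξ ^ e) ^ r)`. Eliminating it makes `ξ ^ e` a root of a nonzero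
    -- quadratic.
    pair-bound : ∀ k k′ → k ℕ.< m → k′ ℕ.< m → ¬ k ≡ k′ → ∑ℕ {Q} (λ i → χ (toℕ i ℕ.+ k ℕ.* ℓ) ℕ.* χ (toℕ i ℕ.+ k′ ℕ.* ℓ)) ℕ.≤ 2
    pair-bound k k′ k<m k′<m k≢k′ = ℕₚ.≤-trans (ℕₚ.≤-reflexive count) (ℕₚ.≮⇒≥ λ 3≤ →
      nontrivial (ξ^≢0 (k ℕ.* ℓ)) (ξ^≢0 (k′ ℕ.* ℓ)) (coset-points-distinct k<m k′<m k≢k′) (^-nonzero r (ξ^≢0 (k′ ℕ.* ℓ)))
        (quadratic-roots c₂ c₁ c₀ (map (ξ ^_) pairs) (exponent-list-unique both?)
          (Allₚ.map⁺ (All.map (λ {e} (agu , agv) → quadratic (A e * ((ξ ^ e) ^ r)) (ξ ^ e) (*-nonzero (a≢0 (e DivMod.mod ℓ)) (^-nonzero r (ξ^≢0 e)))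
            (agrees-shifted e k agu) (agrees-shifted e k′ agv)) (Allₚ.all-filter both? (upTo Q))))
          (ℕₚ.≤-trans 3≤ (ℕₚ.≤-reflexive (sym (Listₚ.length-map (ξ ^_) pairs))))))
      where
      open Elimination (ξ ^ (k ℕ.* ℓ)) (ξ ^ (k′ ℕ.* ℓ)) ((ξ ^ (k ℕ.* ℓ)) ^ r) ((ξ ^ (k′ ℕ.* ℓ)) ^ r)
      both? : ∀ e → Dec (Agrees f (ξ ^ (e ℕ.+ k ℕ.* ℓ)) × Agrees f (ξ ^ (e ℕ.+ k′ ℕ.* ℓ)))
      both? e = agrees? f (ξ ^ (e ℕ.+ k ℕ.* ℓ)) ×-dec agrees? f (ξ ^ (e ℕ.+ k′ ℕ.* ℓ))
      pairs = filter both? (upTo Q)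
      count : ∑ℕ {Q} (λ i → χ (toℕ i ℕ.+ k ℕ.* ℓ) ℕ.* χ (toℕ i ℕ.+ k′ ℕ.* ℓ)) ≡ length pairs
      count = trans (∑ℕ-cong {Q} (λ i → indicator-× (agrees? f (ξ ^ (toℕ i ℕ.+ k ℕ.* ℓ))) (agrees? f (ξ ^ (toℕ i ℕ.+ k′ ℕ.* ℓ)))))
        (sum-indicator both? (λ e → e) Q)

    pair-count-bound : suc (ℕ.pred m) ℕ.* (K ℕ.* K) ℕ.≤ Q ℕ.* (K ℕ.+ ℕ.pred m ℕ.* 2)
    pair-count-bound = subst (λ K → suc (ℕ.pred m) ℕ.* (K ℕ.* K) ℕ.≤ Q ℕ.* (K ℕ.+ ℕ.pred m ℕ.* 2)) (sum-indicator (λ e → agrees? f (ξ ^ e)) (λ e → e) Q)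
      (pair-count {Q} {ℕ.pred m} {ℓ} {2} χ (λ e → cong (λ x → indicator (agrees? f x)) (ξ^-periodic e)) (λ e → idem (agrees? f (ξ ^ e)))
        (λ k k′ k< k′< → pair-bound k k′ (subst (k ℕ.<_) 1+pred[m]≡m k<) (subst (k′ ℕ.<_) 1+pred[m]≡m k′<)))
      where
      idem : ∀ {p} {P : Set p} (d : Dec P) → indicator d ℕ.* indicator d ≡ indicator d
      idem (yes _) = refl
      idem (no _)  = refl

    agreement-bound : ¬ 9 ℕ.* q ℕ.< suc K ℕ.* suc K
    agreement-bound 9q< = conclude (Arithmetic.multiplicity K Q (ℕ.pred m) 1≤K K≤Q large pair-count-bound)
      where
      conclude : ¬ (∃[ M ] (suc M ℕ.* (suc (ℕ.pred m) ℕ.+ M) ℕ.< Q × Q ℕ.+ Q ℕ.≤ K ℕ.* suc M))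
      conclude (M , conditions , degree) =
        ℕₚ.<⇒≱ (points-bound M (subst (λ m → suc M ℕ.* (m ℕ.+ M) ℕ.< Q) 1+pred[m]≡m conditions)) degree
      open NatSolver.+-*-Solver renaming (solve to solveℕ; _:+_ to _⊕_; _:=_ to _⊜_; _:*_ to _⊗_; con to conℕ)
      K≤Q : K ℕ.≤ Q
      K≤Q = ℕₚ.≤-trans (Listₚ.length-filter (λ e → agrees? f (ξ ^ e)) (upTo Q)) (ℕₚ.≤-reflexive (Listₚ.length-upTo Q))
      -- With `q = Q + 1`, strictness of the assumption absorbs the 1 in `(K + 1)² = K² + 2 K + 1`.
      large : 9 ℕ.* Q ℕ.+ 9 ℕ.≤ K ℕ.* K ℕ.+ 2 ℕ.* K
      large = ℕₚ.≤-pred (subst₂ ℕ._<_ (trans (cong (9 ℕ.*_) q≡1+Q) (solveℕ 1 (λ Q → conℕ 9 ⊗ (conℕ 1 ⊕ Q) ⊜ conℕ 9 ⊗ Q ⊕ conℕ 9) refl Q))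
        (solveℕ 1 (λ K → (conℕ 1 ⊕ K) ⊗ (conℕ 1 ⊕ K) ⊜ conℕ 1 ⊕ (K ⊗ K ⊕ conℕ 2 ⊗ K)) refl K) 9q<)
      1≤K : 1 ℕ.≤ K
      1≤K = ℕₚ.n≢0⇒n>0 λ K≡0 → ℕₚ.<⇒≱ (ℕₚ.m≤n+m 1 (9 ℕ.* Q ℕ.+ 8)) (ℕₚ.≤-trans (ℕₚ.≤-reflexive (ℕₚ.+-assoc (9 ℕ.* Q) 8 1)) (subst (λ K → 9 ℕ.* Q ℕ.+ 9 ℕ.≤ K ℕ.* K ℕ.+ 2 ℕ.* K) K≡0 large))

-- From agreement counts to the Carlitz rank.

module CarlitzRankBound
  (F : FiniteField) (ξ : FiniteField.Carrier F) (ξ-primitive : IsPrimitive F ξ)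
  (ℓ : ℕ) .{{_ : ℕ.NonZero ℓ}} (ℓ∣Q : ℓ ∣ (FiniteField.q F ℕ.∸ 1)) (r : ℕ)
  (a : Fin ℓ → FiniteField.Carrier F) (j : ℕ) (a∈C : ∀ i → InCoset F ξ ℓ j (a i))
  (f : FiniteField.Carrier F → FiniteField.Carrier F)
  (f-on-cosets : ∀ i x → InCoset F ξ ℓ (toℕ i) x → f x ≡ FiniteField._*_ F (a i) (FiniteField._^_ F x r))
  where

  open FiniteField F
  open FieldProperties F
  open Stepanov F
  open PrimitiveElement F ξ ξ-primitive
  open CyclotomicMapping F ξ ξ-primitive ℓ ℓ∣Q r a j a∈C f f-on-cosets
  open CarlitzApproximation F
  open ≡-Reasoning

  ∈-elements : ∀ x → x ∈ elements
  ∈-elements x = subst (_∈ elements) (to-from x) (∈ₚ.∈-map⁺ to (∈ₚ.∈-allFin (from x)))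

  ∈-nonzeroElements : ∀ {x} → ¬ x ≡ 0# → x ∈ nonzeroElements
  ∈-nonzeroElements {x} x≢0 = ∈ₚ.∈-filter⁺ (λ x → ¬? (x ≟ 0#)) (∈-elements x) x≢0

  ∈⇒≤maxList : ∀ {n} ns → n ∈ ns → n ℕ.≤ maxList F ns
  ∈⇒≤maxList (n ∷ ns) (here refl) = ℕₚ.m≤m⊔n n (maxList F ns)
  ∈⇒≤maxList (n ∷ ns) (there n∈)  = ℕₚ.≤-trans (∈⇒≤maxList ns n∈) (ℕₚ.m≤n⊔m n (maxList F ns))

  linCount≤linearity : ∀ {b} → ¬ b ≡ 0# → linCount F f b ℕ.≤ linearity F f
  linCount≤linearity b≢0 = ∈⇒≤maxList _ (∈ₚ.∈-map⁺ (linCount F f) (∈-nonzeroElements b≢0))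

  invCount≤invertibility : ∀ {b} → ¬ b ≡ 0# → invCount F f b ℕ.≤ invertibility F f
  invCount≤invertibility b≢0 = ∈⇒≤maxList _ (∈ₚ.∈-map⁺ (invCount F f) (∈-nonzeroElements b≢0))

  module _ {n : ℕ} (approximation : Approximation f n) where

    open Approximation approximation
    open Moebius F α β γ δ

    q≤n+ : (xs : List Carrier) → (∀ x → Agrees f x → x ∈ xs) → q ℕ.≤ n ℕ.+ length xs
    q≤n+ xs ∈xs = ℕₚ.≤-trans (covering-length (poles ++ xs) covers)
      (ℕₚ.≤-reflexive (trans (Listₚ.length-++ poles) (cong (ℕ._+ length xs) length-poles)))
      where
      covers : ∀ x → x ∈ poles ++ xs
      covers x with approximates x
      ... | inj₁ x∈     = ∈ₚ.∈-++⁺ˡ x∈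
      ... | inj₂ agrees = ∈ₚ.∈-++⁺ʳ poles (∈xs x agrees)

    generic-bound : (¬ α ≡ 0# × ¬ β ≡ 0#) ⊎ (¬ γ ≡ 0# × ¬ δ ≡ 0#) → (q ℕ.∸ n) ℕ.* (q ℕ.∸ n) ℕ.≤ 9 ℕ.* q
    generic-bound nondegenerate = ℕₚ.≮⇒≥ λ 9q< → agreement-bound (ℕₚ.<-≤-trans 9q< (ℕₚ.*-mono-≤ q∸n≤ q∸n≤))
      where
      open Agreement α β γ δ nonsingular nondegenerate
      -- `K` counts only nonzero agreement points. The possible agreement at `0#` accounts for the
      -- `K + 1` in the bound.
      xs = 0# ∷ map (ξ ^_) agreeing
      ∈xs : ∀ x → Agrees f x → x ∈ xs
      ∈xs x agrees with x ≟ 0#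
      ... | yes x≡0 = here x≡0
      ... | no x≢0 with e , e<Q , refl ← log x≢0 = there (∈ₚ.∈-map⁺ (ξ ^_) (∈ₚ.∈-filter⁺ (λ e → agrees? f (ξ ^ e)) (∈ₚ.∈-upTo⁺ e<Q) agrees))
      q∸n≤ : q ℕ.∸ n ℕ.≤ suc K
      q∸n≤ = ℕₚ.m≤n+o⇒m∸n≤o q n (ℕₚ.≤-trans (q≤n+ xs ∈xs) (ℕₚ.≤-reflexive (cong (λ k → n ℕ.+ suc k) (Listₚ.length-map (ξ ^_) agreeing))))

    linear-bound : β ≡ 0# → γ ≡ 0# → q ℕ.≤ n ℕ.+ linearity F f
    linear-bound β≡0 γ≡0 = ℕₚ.≤-trans (q≤n+ (filter (λ x → f x ≟ (b * x)) elements)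
      (λ x agrees → ∈ₚ.∈-filter⁺ (λ x → f x ≟ (b * x)) (∈-elements x) (value x agrees))) (ℕₚ.+-monoʳ-≤ n (linCount≤linearity b≢0))
      where
      αδ≢0 : ¬ α * δ ≡ 0#
      αδ≢0 eq = nonsingular (trans eq (sym (trans (cong (_* γ) β≡0) (zeroˡ γ))))
      δ≢0 = xy≢0⇒y≢0 αδ≢0
      b = (δ ⁻¹) * α
      b≢0 : ¬ b ≡ 0#
      b≢0 = *-nonzero (⁻¹-nonzero δ≢0) (xy≢0⇒x≢0 αδ≢0)
      value : ∀ x → Agrees f x → f x ≡ b * x
      value x (_ , eq) = begin
        f x                       ≡⟨ ⁻¹-cancelˡ (f x) δ≢0 ⟨
        (δ ⁻¹) * (δ * f x)        ≡⟨ *-congˡ (trans (*-comm δ (f x)) (*-congˡ (sym denominator≡δ))) ⟩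
        (δ ⁻¹) * (f x * denominator x) ≡⟨ *-congˡ (trans eq (trans (+-congˡ β≡0) (+-identityʳ _))) ⟩
        (δ ⁻¹) * (α * x)          ≡⟨ *-assoc _ _ _ ⟨
        b * x                     ∎
        where
        denominator≡δ : denominator x ≡ δ
        denominator≡δ = trans (+-congʳ (trans (cong (_* x) γ≡0) (zeroˡ x))) (+-identityˡ δ)

    -- Here `0#` is the pole of the Moebius map, so all agreement points are nonzero, as the
    -- definition of invertibility requires.
    inverse-bound : α ≡ 0# → δ ≡ 0# → q ℕ.≤ n ℕ.+ invertibility F f
    inverse-bound α≡0 δ≡0 = ℕₚ.≤-trans (q≤n+ (filter (λ x → f x ≟ (b * (x ⁻¹))) nonzeroElements)
      (λ x agrees → ∈ₚ.∈-filter⁺ (λ x → f x ≟ (b * (x ⁻¹))) (∈-nonzeroElements (x≢0 x agrees)) (value x agrees))) (ℕₚ.+-monoʳ-≤ n (invCount≤invertibility b≢0))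
      where
      βγ≢0 : ¬ β * γ ≡ 0#
      βγ≢0 eq = nonsingular (trans (trans (cong (_* δ) α≡0) (zeroˡ δ)) (sym eq))
      γ≢0 = xy≢0⇒y≢0 βγ≢0
      b = (γ ⁻¹) * β
      b≢0 : ¬ b ≡ 0#
      b≢0 = *-nonzero (⁻¹-nonzero γ≢0) (xy≢0⇒x≢0 βγ≢0)
      denominator≡γx : ∀ x → denominator x ≡ γ * x
      denominator≡γx x = trans (+-congˡ δ≡0) (+-identityʳ _)
      x≢0 : ∀ x → Agrees f x → ¬ x ≡ 0#
      x≢0 x (D≢0 , _) = xy≢0⇒y≢0 (λ eq → D≢0 (trans (denominator≡γx x) eq))
      value : ∀ x → Agrees f x → f x ≡ b * (x ⁻¹)
      value x agrees@(_ , eq) = begin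
        f x                                  ≡⟨ ⁻¹-cancelˡ (f x) (x≢0 x agrees) ⟨
        (x ⁻¹) * (x * f x)                   ≡⟨ *-congˡ (⁻¹-cancelˡ (x * f x) γ≢0) ⟨
        (x ⁻¹) * ((γ ⁻¹) * (γ * (x * f x)))  ≡⟨ *-congˡ (*-congˡ (trans (sym (*-assoc _ _ _)) (*-comm _ _))) ⟩
        (x ⁻¹) * ((γ ⁻¹) * (f x * (γ * x)))  ≡⟨ *-congˡ (*-congˡ (trans (*-congˡ (sym (denominator≡γx x))) (trans eq (trans (+-congʳ (trans (cong (_* x) α≡0) (zeroˡ x))) (+-identityˡ β))))) ⟩
        (x ⁻¹) * b                           ≡⟨ *-comm _ _ ⟩
        b * (x ⁻¹)                           ∎

    -- If neither form has both coefficients nonzero, each has a zero coefficient. Zeros in the same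
    -- column contradict nonsingularity, and zeros on a diagonal leave `b x` or `b / x`.
    rank-bound : ((q ℕ.∸ n) ℕ.* (q ℕ.∸ n) ℕ.≤ 9 ℕ.* q) ⊎ (q ℕ.≤ n ℕ.+ linearity F f) ⊎ (q ℕ.≤ n ℕ.+ invertibility F f)
    rank-bound with α ≟ 0# | β ≟ 0# | γ ≟ 0# | δ ≟ 0#
    ... | no α≢0  | no β≢0  | _       | _       = inj₁ (generic-bound (inj₁ (α≢0 , β≢0)))
    ... | _       | _       | no γ≢0  | no δ≢0  = inj₁ (generic-bound (inj₂ (γ≢0 , δ≢0)))
    ... | _       | yes β≡0 | yes γ≡0 | _       = inj₂ (inj₁ (linear-bound β≡0 γ≡0))
    ... | yes α≡0 | _       | _       | yes δ≡0 = inj₂ (inj₂ (inverse-bound α≡0 δ≡0))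
    ... | yes α≡0 | _       | yes γ≡0 | _       = contradiction (trans (trans (cong (_* δ) α≡0) (zeroˡ δ)) (sym (trans (cong (β *_) γ≡0) (zeroʳ β)))) nonsingular
    ... | _       | yes β≡0 | _       | yes δ≡0 = contradiction (trans (trans (cong (α *_) δ≡0) (zeroʳ α)) (sym (trans (cong (_* γ) β≡0) (zeroˡ γ)))) nonsingular

  approximation-of-rep : ∀ n c → CarlitzRep F f n c → Approximation f n
  approximation-of-rep n c (c₀≢0 , _ , f≡) = record
    { nonsingular = nonsingular ; length-poles = length-poles ; approximates = λ x → transfer x (approximates x) }
    where
    open Approximation (carlitz-approximation n c c₀≢0)
    transfer : ∀ x → x ∈ poles ⊎ Moebius.Agrees F α β γ δ (carlitzInner F n c) x → x ∈ poles ⊎ Moebius.Agrees F α β γ δ f x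
    transfer x (inj₁ x∈)         = inj₁ x∈
    transfer x (inj₂ (D≢0 , eq)) = inj₂ (D≢0 , trans (*-congʳ (f≡ x)) eq)

open import Data.Nat using (_≤_; _<_; _∸_; _+_; _*_; NonZero)
open FiniteField using (q; Carrier; 0#)

-- The first alternative is the square of `q - n ≤ 3 q^{1/2}`, where truncated subtraction covers
-- `n ≥ q`. A bound for every representation is a bound for the shortest one, hence for `Crk(f)`;
-- the maximum becomes a disjunction.
theorem2 : (F : FiniteField) →
    IsPrimePower F (q F) →
    (ξ : Carrier F) → IsPrimitive F ξ →
    (ℓ : ℕ) → .{{_ : NonZero ℓ}} → ℓ ∣ (q F ∸ 1) →
    (r : ℕ) → 1 ≤ r →
    (a : Fin ℓ → Carrier F) →
    (j : ℕ) → j < ℓ → (∀ i → InCoset F ξ ℓ j (a i)) →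
    (f : Carrier F → Carrier F) → IsPermutation F f → f (0# F) ≡ 0# F →
    (∀ (i : Fin ℓ) (x : Carrier F) → InCoset F ξ ℓ (toℕ i) x →
       f x ≡ FiniteField._*_ F (a i) (FiniteField._^_ F x r)) →
    ∀ (n : ℕ) (c : ℕ → Carrier F) → CarlitzRep F f n c →
    ((q F ∸ n) * (q F ∸ n) ≤ 9 * q F) ⊎ (q F ≤ n + linearity F f) ⊎ (q F ≤ n + invertibility F f)
theorem2 F _ ξ ξ-primitive ℓ ℓ∣Q r _ a j _ a∈C f _ _ f-on-cosets n c rep = rank-bound (approximation-of-rep n c rep)
  where open CarlitzRankBound F ξ ξ-primitive ℓ ℓ∣Q r a j a∈C f f-on-cosets
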